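{- Let $m$ be a positive integer, let $\mathcal{V}$ be any set of prime numbers each of which is coprime to $m$ and does not exceed $m^{1/2}$, and let $S$ and $L$ be any integers with $0<L\le m$. Let $J$ denote the number of solutions $(v_1,v_2,y_1,y_2)$ of the congruence $$v_1y_1\equiv v_2y_2\pmod m,\qquad v_1,v_2\in\mathcal{V},\qquad S+1\le y_1,y_2\le S+L,$$ with $y_1,y_2$ integers. Then $$J=\frac{|\mathcal{V}|^2L^2}{m}+|\mathcal{V}|L-\frac{|\mathcal{V}|L^2}{m}+O\left(\frac{m^2\log^2 m}{\phi(m)}\right).$$
   Context: $|\mathcal{V}|$ is the number of elements of $\mathcal{V}$ and $\phi$ is Euler's totient function. The constant implied by $O$ is absolute (uniform in $m,\mathcal{V},S,L$). -}

module Defs where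

open import Data.Nat.Base as ℕ using (ℕ; zero; suc; NonZero; z≤n; s≤s)
import Data.Nat.Properties as ℕ
open import Data.Nat.Coprimality using (Coprime; coprime?; 1-coprimeTo)
open import Data.Integer.Base as ℤ using (ℤ; +_; +[1+_])
import Data.Integer.Properties as ℤ
open import Algebra.Properties.AbelianGroup ℤ.+-0-abelianGroup using (∙-cancelˡ)
open import Data.Integer.Divisibility.Signed using (_∣_; _∣?_)
open import Data.Integer.Solver using () renaming (module +-*-Solver to ℤ-Solver)
open import Data.Rational.Base using (ℚ; mkℚ; 0ℚ; 1ℚ; ∣_∣; _+_; _-_; -_; _*_; _≤_; _<_; *≤*; *<*; _/_; 1/_; toℚᵘ; Positive; positive; nonNegative)
open import Data.Rational.Properties
open import Data.Rational.Solver using (module +-*-Solver)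
import Data.Rational.Unnormalised.Base as ℚᵘ
import Data.Rational.Unnormalised.Properties as ℚᵘ
open import Data.List.Base using (List; length; filter; applyUpTo; cartesianProduct)
open import Data.List.Membership.Propositional using (_∈_)
open import Data.List.Membership.Propositional.Properties
  using (∈-filter⁺; ∈-filter⁻; ∈-applyUpTo⁺; ∈-applyUpTo⁻; ∈-cartesianProduct⁺; ∈-cartesianProduct⁻; ∈-length)
open import Data.List.Relation.Unary.Unique.Propositional using (Unique)
import Data.List.Relation.Unary.Unique.Propositional.Properties as Unique
open import Data.Product.Base using (∃; _×_; _,_; proj₁; proj₂)
open import Data.Sum.Base using (inj₁; inj₂)
open import Function.Bundles using (_⇔_; mk⇔)
open import Relation.Unary using (Decidable)
open import Relation.Binary.PropositionalEquality using (_≡_; refl; sym; trans; cong; cong₂; subst; subst₂)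

φ : ℕ → ℕ
φ m = length (filter (λ a → coprime? a m) (applyUpTo suc m))

φ-nonZero : ∀ m .{{_ : NonZero m}} → NonZero (φ m)
φ-nonZero m@(suc _) = ℕ.>-nonZero
  (∈-length (∈-filter⁺ (λ a → coprime? a m) (∈-applyUpTo⁺ suc (s≤s z≤n)) (1-coprimeTo m)))

infix 4 _≅_[mod_]

_≅_[mod_] : ℤ → ℤ → ℕ → Set
a ≅ b [mod m ] = + m ∣ a ℤ.- b

-- S + 1, …, S + L
interval : ℤ → ℕ → List ℤ
interval S L = applyUpTo (λ i → S ℤ.+ +[1+ i ]) L

Quadruple : Set
Quadruple = ℕ × ℕ × ℤ × ℤ

SolvesCongruence : ℕ → Quadruple → Set
SolvesCongruence m (v₁ , v₂ , y₁ , y₂) = + v₁ ℤ.* y₁ ≅ + v₂ ℤ.* y₂ [mod m ]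

solvesCongruence? : ∀ m → Decidable (SolvesCongruence m)
solvesCongruence? m _ = + m ∣? _

solutions : ℕ → List ℕ → ℤ → ℕ → List Quadruple
solutions m V S L = filter (solvesCongruence? m)
  (cartesianProduct V (cartesianProduct V (cartesianProduct (interval S L) (interval S L))))

-- Counts solutions without multiplicity when V is duplicate-free: see
-- ∈-solutions and solutions-unique.
J : ℕ → List ℕ → ℤ → ℕ → ℕ
J m V S L = length (solutions m V S L)

∈-interval : ∀ {S L y} → y ∈ interval S L ⇔ (S ℤ.+ + 1 ℤ.≤ y × y ℤ.≤ S ℤ.+ + L)
∈-interval {S} {L} {y} = mk⇔ to from
  where
  to : y ∈ interval S L → S ℤ.+ + 1 ℤ.≤ y × y ℤ.≤ S ℤ.+ + L
  to y∈ with i , i<L , refl ← ∈-applyUpTo⁻ (λ i → S ℤ.+ +[1+ i ]) y∈ =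
    ℤ.+-monoʳ-≤ S (ℤ.+≤+ (s≤s z≤n)) , ℤ.+-monoʳ-≤ S (ℤ.+≤+ i<L)

  from : S ℤ.+ + 1 ℤ.≤ y × y ℤ.≤ S ℤ.+ + L → y ∈ interval S L
  from (lo , hi) = go (y ℤ.- S) refl
      (subst (ℤ._≤ y ℤ.- S) (cancel (+ 1)) (ℤ.+-monoˡ-≤ (ℤ.- S) lo))
      (subst (y ℤ.- S ℤ.≤_) (cancel (+ L)) (ℤ.+-monoˡ-≤ (ℤ.- S) hi))
    where
    open ℤ-Solver
    cancel : ∀ z → S ℤ.+ z ℤ.- S ≡ z
    cancel = solve 2 (λ s z → s :+ z :- s := z) refl S
    recover : S ℤ.+ (y ℤ.- S) ≡ y
    recover = solve 2 (λ s z → s :+ (z :- s) := z) refl S y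
    go : ∀ d → y ℤ.- S ≡ d → + 1 ℤ.≤ d → d ℤ.≤ + L → y ∈ interval S L
    go (+ zero) _ (ℤ.+≤+ ()) _
    go +[1+ i ] eq _ (ℤ.+≤+ i<L) = subst (_∈ interval S L)
      (trans (cong (ℤ._+_ S) (sym eq)) recover)
      (∈-applyUpTo⁺ (λ i → S ℤ.+ +[1+ i ]) i<L)

interval-unique : ∀ S L → Unique (interval S L)
interval-unique S L = Unique.applyUpTo⁺₁ _ L λ {i} {j} i<j _ eq →
  ℕ.<⇒≢ i<j (ℤ.+[1+-injective (∙-cancelˡ S _ _ eq))

∈-solutions : ∀ {m V S L v₁ v₂ y₁ y₂} →
  (v₁ , v₂ , y₁ , y₂) ∈ solutions m V S L ⇔
  (v₁ ∈ V × v₂ ∈ V × y₁ ∈ interval S L × y₂ ∈ interval S L ×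
   + v₁ ℤ.* y₁ ≅ + v₂ ℤ.* y₂ [mod m ])
∈-solutions {m} {V} {S} {L} = mk⇔
  (λ s → let (q , e) = ∈-filter⁻ (solvesCongruence? m) {xs = cartesianProduct V (cartesianProduct V (cartesianProduct I I))} s
             (a , q′) = ∈-cartesianProduct⁻ V (cartesianProduct V (cartesianProduct I I)) q
             (b , q″) = ∈-cartesianProduct⁻ V (cartesianProduct I I) q′
             (c , d) = ∈-cartesianProduct⁻ I I q″
         in a , b , c , d , e)
  (λ (a , b , c , d , e) → ∈-filter⁺ (solvesCongruence? m)
    (∈-cartesianProduct⁺ a (∈-cartesianProduct⁺ b (∈-cartesianProduct⁺ c d))) e)
  where I = interval S L

solutions-unique : ∀ {m V S L} → Unique V → Unique (solutions m V S L)
solutions-unique {m} {V} {S} {L} u = Unique.filter⁺ (solvesCongruence? m)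
  (Unique.cartesianProduct⁺ u (Unique.cartesianProduct⁺ u
    (Unique.cartesianProduct⁺ (interval-unique S L) (interval-unique S L))))

private
  module _ where
    open +-*-Solver

    split : ∀ a b → a ≡ (a - b) + b
    split = solve 2 (λ a b → a := (a :- b) :+ b) refl

    *-split : ∀ a b c d → a * b - c * d ≡ a * (b - d) + (a - c) * d
    *-split = solve 4 (λ a b c d → a :* b :- c :* d := a :* (b :- d) :+ (a :- c) :* d) refl

    *-collect : ∀ a d b → a * d + d * b ≡ d * (a + b)
    *-collect = solve 3 (λ a d b → a :* d :+ d :* b := d :* (a :+ b)) refl

    -‿+-cancel : ∀ h g r → h - g ≡ (h + r) - (g + r)
    -‿+-cancel = solve 3 (λ h g r → h :- g := (h :+ r) :- (g :+ r)) refl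

    -+-cancel : ∀ h g r → (h - (g + r)) + r ≡ h - g
    -+-cancel = solve 3 (λ h g r → (h :- (g :+ r)) :+ r := h :- g) refl

    +-‿comm : ∀ h g r → (h + r) - g ≡ (h - g) + r
    +-‿comm = solve 3 (λ h g r → (h :+ r) :- g := (h :- g) :+ r) refl

    +-‿cancel : ∀ a r → (a + r) - a ≡ r
    +-‿cancel = solve 2 (λ a r → (a :+ r) :- a := r) refl

    neg-swap : ∀ a b → - (a - b) ≡ b - a
    neg-swap = solve 2 (λ a b → :- (a :- b) := b :- a) refl

IsCauchy : (ℕ → ℚ) → Set
IsCauchy x = ∀ ε → 0ℚ < ε → ∃ λ N → ∀ i j → N ℕ.≤ i → N ℕ.≤ j → ∣ x i - x j ∣ ≤ ε

record ℝ : Set where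
  constructor mkℝ
  field
    seq    : ℕ → ℚ
    cauchy : IsCauchy seq

open ℝ public

infix 4 _≤ᴿ_

-- The order of the limits; it does not depend on the representing sequences.
_≤ᴿ_ : ℝ → ℝ → Set
x ≤ᴿ y = ∀ ε → 0ℚ < ε → ∃ λ N → ∀ n → N ℕ.≤ n → seq x n ≤ seq y n + ε

fromℚ : ℚ → ℝ
fromℚ q = mkℝ (λ _ → q) λ ε 0<ε → 0 , λ _ _ _ _ →
  subst (_≤ ε) (sym (cong ∣_∣ (+-inverseʳ q))) (<⇒≤ 0<ε)

private
  Bound : (ℕ → ℚ) → Set
  Bound x = ∃ λ B → Positive B × ∃ λ N → ∀ i → N ℕ.≤ i → ∣ x i ∣ ≤ B

  Close : (ℕ → ℚ) → ℚ → Set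
  Close x ε = ∃ λ N → ∀ i j → N ℕ.≤ i → N ℕ.≤ j → ∣ x i - x j ∣ ≤ ε

  eventually-bounded : ∀ {x} → IsCauchy x → Bound x
  eventually-bounded {x} c with N , close ← c 1ℚ (positive⁻¹ 1ℚ) =
    1ℚ + ∣ x N ∣ , pos , N , λ i N≤i → begin
      ∣ x i ∣                    ≡⟨ cong ∣_∣ (split (x i) (x N)) ⟩
      ∣ (x i - x N) + x N ∣      ≤⟨ ∣p+q∣≤∣p∣+∣q∣ (x i - x N) (x N) ⟩
      ∣ x i - x N ∣ + ∣ x N ∣    ≤⟨ +-monoˡ-≤ ∣ x N ∣ (close i N N≤i ℕ.≤-refl) ⟩
      1ℚ + ∣ x N ∣               ∎
    where
    open ≤-Reasoning
    pos : Positive (1ℚ + ∣ x N ∣)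
    pos = positive (+-mono-<-≤ (positive⁻¹ 1ℚ) (0≤∣p∣ (x N)))

  *-close : ∀ A B δ .{{_ : Positive A}} .{{_ : Positive B}} .{{_ : Positive δ}} a b c d →
    ∣ a ∣ ≤ A → ∣ d ∣ ≤ B → ∣ a - c ∣ ≤ δ → ∣ b - d ∣ ≤ δ → ∣ a * b - c * d ∣ ≤ δ * (A + B)
  *-close A B δ a b c d a≤A d≤B ac bd = begin
    ∣ a * b - c * d ∣                           ≡⟨ cong ∣_∣ (*-split a b c d) ⟩
    ∣ a * (b - d) + (a - c) * d ∣               ≤⟨ ∣p+q∣≤∣p∣+∣q∣ (a * (b - d)) ((a - c) * d) ⟩
    ∣ a * (b - d) ∣ + ∣ (a - c) * d ∣           ≡⟨ cong₂ _+_ (∣p*q∣≡∣p∣*∣q∣ a (b - d)) (∣p*q∣≡∣p∣*∣q∣ (a - c) d) ⟩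
    ∣ a ∣ * ∣ b - d ∣ + ∣ a - c ∣ * ∣ d ∣       ≤⟨ +-mono-≤ left right ⟩
    A * δ + δ * B                               ≡⟨ *-collect A δ B ⟩
    δ * (A + B)                                 ∎
    where
    open ≤-Reasoning
    instance
      A≥0 = pos⇒nonNeg A
      δ≥0 = pos⇒nonNeg δ
    left : ∣ a ∣ * ∣ b - d ∣ ≤ A * δ
    left = ≤-trans (*-monoʳ-≤-nonNeg ∣ b - d ∣ {{∣-∣-nonNeg (b - d)}} a≤A) (*-monoˡ-≤-nonNeg A bd)
    right : ∣ a - c ∣ * ∣ d ∣ ≤ δ * B
    right = ≤-trans (*-monoʳ-≤-nonNeg ∣ d ∣ {{∣-∣-nonNeg d}} ac) (*-monoˡ-≤-nonNeg δ d≤B)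

  quotient : ∀ ε D → Positive ε → Positive D → ∃ λ δ → Positive δ × δ * D ≡ ε
  quotient ε D ε>0 D>0 = ε * 1/ D , pos*pos⇒pos ε (1/ D) {{1/pos⇒pos D}} ,
    trans (*-assoc ε (1/ D) D) (trans (cong (ε *_) (*-inverseˡ D)) (*-identityʳ ε))
    where
    instance
      _ = ε>0
      _ = D>0
      D≢0 = pos⇒nonZero D

  *-Close : ∀ {x y ε δ} ((A , _) : Bound x) ((B , _) : Bound y) → Positive δ → δ * (A + B) ≡ ε →
    Close x δ → Close y δ → Close (λ n → x n * y n) ε
  *-Close {x} {y} {ε} {δ} (A , A>0 , N₁ , x≤A) (B , B>0 , N₂ , y≤B) δ>0 δ[A+B]≡ε (N₃ , x-close) (N₄ , y-close) =
    (N₁ ℕ.+ N₂) ℕ.+ (N₃ ℕ.+ N₄) , close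
    where
    close : ∀ i j → (N₁ ℕ.+ N₂) ℕ.+ (N₃ ℕ.+ N₄) ℕ.≤ i → (N₁ ℕ.+ N₂) ℕ.+ (N₃ ℕ.+ N₄) ℕ.≤ j →
      ∣ x i * y i - x j * y j ∣ ≤ ε
    close i j N≤i N≤j = subst (∣ x i * y i - x j * y j ∣ ≤_) δ[A+B]≡ε
      (*-close A B δ {{A>0}} {{B>0}} {{δ>0}} (x i) (y i) (x j) (y j)
        (x≤A i (ℕ.≤-trans N₁≤ N≤i)) (y≤B j (ℕ.≤-trans N₂≤ N≤j))
        (x-close i j (ℕ.≤-trans N₃≤ N≤i) (ℕ.≤-trans N₃≤ N≤j))
        (y-close i j (ℕ.≤-trans N₄≤ N≤i) (ℕ.≤-trans N₄≤ N≤j)))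
      where
      N₁≤ = ℕ.≤-trans (ℕ.m≤m+n N₁ N₂) (ℕ.m≤m+n (N₁ ℕ.+ N₂) (N₃ ℕ.+ N₄))
      N₂≤ = ℕ.≤-trans (ℕ.m≤n+m N₂ N₁) (ℕ.m≤m+n (N₁ ℕ.+ N₂) (N₃ ℕ.+ N₄))
      N₃≤ = ℕ.≤-trans (ℕ.m≤m+n N₃ N₄) (ℕ.m≤n+m (N₃ ℕ.+ N₄) (N₁ ℕ.+ N₂))
      N₄≤ = ℕ.≤-trans (ℕ.m≤n+m N₄ N₃) (ℕ.m≤n+m (N₃ ℕ.+ N₄) (N₁ ℕ.+ N₂))

  *-cauchy : ∀ {x y} → IsCauchy x → IsCauchy y → IsCauchy (λ n → x n * y n)
  *-cauchy {x} {y} cx cy ε 0<ε =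
    let bx@(A , A>0 , _) = eventually-bounded {x} cx
        by@(B , B>0 , _) = eventually-bounded {y} cy
        A+B>0 = positive (+-mono-< (positive⁻¹ A {{A>0}}) (positive⁻¹ B {{B>0}}))
        δ , δ>0 , δ[A+B]≡ε = quotient ε (A + B) (positive 0<ε) A+B>0
        0<δ = positive⁻¹ δ {{δ>0}}
    in *-Close {x} {y} bx by δ>0 δ[A+B]≡ε (cx δ 0<δ) (cy δ 0<δ)

infixl 7 _*ᴿ_

_*ᴿ_ : ℝ → ℝ → ℝ
seq    (x *ᴿ y) n = seq x n * seq y n
cauchy (x *ᴿ y)   = *-cauchy {seq x} {seq y} (cauchy x) (cauchy y)

harmonic : ℕ → ℚ
harmonic zero    = 0ℚ
harmonic (suc n) = harmonic n + + 1 / suc n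

-- With N = n + 1, this is the sum of 1/j over N < j ≤ N m, that is, the
-- right-endpoint Riemann sum with mesh 1/N of the integral of 1/t over [1, m].

log-seq : ℕ → ℕ → ℚ
log-seq m n = harmonic (suc n ℕ.* m) - harmonic (suc n)

private
  /-≤ : ∀ p d q e .{{_ : NonZero d}} .{{_ : NonZero e}} → p ℕ.* e ℕ.≤ q ℕ.* d → + p / d ≤ + q / e
  /-≤ p d@(suc d-1) q e@(suc e-1) le = toℚᵘ-cancel-≤ (begin
    toℚᵘ (+ p / d)      ≃⟨ toℚᵘ-fromℚᵘ (ℚᵘ.mkℚᵘ (+ p) d-1) ⟩
    ℚᵘ.mkℚᵘ (+ p) d-1   ≤⟨ ℚᵘ.*≤* (subst₂ ℤ._≤_ (ℤ.pos-* p e) (ℤ.pos-* q d) (ℤ.+≤+ le)) ⟩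
    ℚᵘ.mkℚᵘ (+ q) e-1   ≃⟨ toℚᵘ-fromℚᵘ (ℚᵘ.mkℚᵘ (+ q) e-1) ⟨
    toℚᵘ (+ q / e)      ∎)
    where open ℚᵘ.≤-Reasoning

  /-≡ : ∀ p d q e .{{_ : NonZero d}} .{{_ : NonZero e}} → p ℕ.* e ≡ q ℕ.* d → + p / d ≡ + q / e
  /-≡ p d q e eq = ≤-antisym (/-≤ p d q e (ℕ.≤-reflexive eq)) (/-≤ q e p d (ℕ.≤-reflexive (sym eq)))

  1+/ : ∀ k d .{{_ : NonZero d}} → + k / d + + 1 / d ≡ + suc k / d
  1+/ k d@(suc d-1) = toℚᵘ-injective (begin
    toℚᵘ (+ k / d + + 1 / d)                   ≈⟨ toℚᵘ-homo-+ (+ k / d) (+ 1 / d) ⟩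
    toℚᵘ (+ k / d) ℚᵘ.+ toℚᵘ (+ 1 / d)         ≈⟨ ℚᵘ.+-cong (toℚᵘ-fromℚᵘ (ℚᵘ.mkℚᵘ (+ k) d-1)) (toℚᵘ-fromℚᵘ (ℚᵘ.mkℚᵘ (+ 1) d-1)) ⟩
    ℚᵘ.mkℚᵘ (+ k) d-1 ℚᵘ.+ ℚᵘ.mkℚᵘ (+ 1) d-1   ≈⟨ ℚᵘ.*≡* (solve 2 (λ k d → (k :* d :+ con (+ 1) :* d) :* d := (con (+ 1) :+ k) :* (d :* d)) refl (+ k) (+ d)) ⟩
    ℚᵘ.mkℚᵘ (+ suc k) d-1                      ≈⟨ toℚᵘ-fromℚᵘ (ℚᵘ.mkℚᵘ (+ suc k) d-1) ⟨
    toℚᵘ (+ suc k / d)                         ∎)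
    where
    open import Relation.Binary.Reasoning.Setoid ℚᵘ.≃-setoid
    open ℤ-Solver

  harmonic-upper : ∀ k a .{{_ : NonZero a}} → harmonic (k ℕ.+ a) ≤ harmonic a + + k / a
  harmonic-upper zero a = ≤-reflexive (sym (trans (cong (_+_ (harmonic a)) (0/n≡0 a)) (+-identityʳ _)))
  harmonic-upper (suc k) a = begin
    harmonic (k ℕ.+ a) + + 1 / suc (k ℕ.+ a)  ≤⟨ +-mono-≤ (harmonic-upper k a) (/-≤ 1 (suc (k ℕ.+ a)) 1 a (ℕ.*-monoʳ-≤ 1 (ℕ.m≤n+m a (suc k)))) ⟩
    (harmonic a + + k / a) + + 1 / a          ≡⟨ +-assoc (harmonic a) (+ k / a) (+ 1 / a) ⟩
    harmonic a + (+ k / a + + 1 / a)          ≡⟨ cong (_+_ (harmonic a)) (1+/ k a) ⟩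
    harmonic a + + suc k / a                  ∎
    where open ≤-Reasoning

  harmonic-lower : ∀ k a b .{{_ : NonZero b}} → k ℕ.+ a ℕ.≤ b → harmonic a + + k / b ≤ harmonic (k ℕ.+ a)
  harmonic-lower zero a b _ = ≤-reflexive (trans (cong (_+_ (harmonic a)) (0/n≡0 b)) (+-identityʳ _))
  harmonic-lower (suc k) a b le = begin
    harmonic a + + suc k / b                  ≡⟨ cong (_+_ (harmonic a)) (1+/ k b) ⟨
    harmonic a + (+ k / b + + 1 / b)          ≡⟨ +-assoc (harmonic a) (+ k / b) (+ 1 / b) ⟨
    (harmonic a + + k / b) + + 1 / b          ≤⟨ +-mono-≤ (harmonic-lower k a b (ℕ.<⇒≤ le)) (/-≤ 1 b 1 (suc (k ℕ.+ a)) (ℕ.*-monoʳ-≤ 1 le)) ⟩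
    harmonic (k ℕ.+ a) + + 1 / suc (k ℕ.+ a)  ∎
    where open ≤-Reasoning

  m/nm : ∀ m n .{{_ : NonZero m}} .{{_ : NonZero n}} .{{_ : NonZero (n ℕ.* m)}} → + m / (n ℕ.* m) ≡ + 1 / n
  m/nm m n = /-≡ m (n ℕ.* m) 1 n (trans (ℕ.*-comm m n) (sym (ℕ.*-identityˡ (n ℕ.* m))))

module _ (m : ℕ) .{{_ : NonZero m}} where

  private
    upper : ℕ → ℚ
    upper n = log-seq m n + + 1 / suc n

    log-step : ∀ n → log-seq m n ≤ log-seq m (suc n)
    log-step n = begin
      h - g                ≡⟨ -‿+-cancel h g r ⟩
      (h + r) - (g + r)    ≤⟨ +-monoˡ-≤ (- (g + r)) (subst (λ q → h + q ≤ h′) (m/nm m (suc (suc n))) (harmonic-lower m (suc n ℕ.* m) (suc (suc n) ℕ.* m) ℕ.≤-refl)) ⟩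
      h′ - (g + r)         ∎
      where
      open ≤-Reasoning
      instance _ = ℕ.m*n≢0 (suc (suc n)) m
      h = harmonic (suc n ℕ.* m)
      h′ = harmonic (suc (suc n) ℕ.* m)
      g = harmonic (suc n)
      r = + 1 / suc (suc n)

    upper-step : ∀ n → upper (suc n) ≤ upper n
    upper-step n = begin
      (h′ - (g + r′)) + r′  ≡⟨ -+-cancel h′ g r′ ⟩
      h′ - g                ≤⟨ +-monoˡ-≤ (- g) (subst (λ q → h′ ≤ h + q) (m/nm m (suc n)) (harmonic-upper m (suc n ℕ.* m))) ⟩
      (h + r) - g           ≡⟨ +-‿comm h g r ⟩
      (h - g) + r           ∎
      where
      open ≤-Reasoning
      instance _ = ℕ.m*n≢0 (suc n) m
      h = harmonic (suc n ℕ.* m)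
      h′ = harmonic (suc (suc n) ℕ.* m)
      g = harmonic (suc n)
      r = + 1 / suc n
      r′ = + 1 / suc (suc n)

    monotone : ∀ d n → log-seq m n ≤ log-seq m (d ℕ.+ n)
    monotone zero    n = ≤-refl
    monotone (suc d) n = ≤-trans (monotone d n) (log-step (d ℕ.+ n))

    antitone : ∀ d n → upper (d ℕ.+ n) ≤ upper n
    antitone zero    n = ≤-refl
    antitone (suc d) n = ≤-trans (upper-step (d ℕ.+ n)) (antitone d n)

    below-upper : ∀ n → log-seq m n ≤ upper n
    below-upper n = subst (_≤ upper n) (+-identityʳ _) (+-monoʳ-≤ (log-seq m n)
      (subst (_≤ + 1 / suc n) (0/n≡0 1) (/-≤ 0 1 1 (suc n) z≤n)))

    gap : ∀ d n → ∣ log-seq m (d ℕ.+ n) - log-seq m n ∣ ≤ + 1 / suc n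
    gap d n = begin
      ∣ b - a ∣     ≡⟨ 0≤p⇒∣p∣≡p (subst (_≤ b - a) (+-inverseʳ a) (+-monoˡ-≤ (- a) (monotone d n))) ⟩
      b - a         ≤⟨ +-monoˡ-≤ (- a) (≤-trans (below-upper (d ℕ.+ n)) (antitone d n)) ⟩
      (a + r) - a   ≡⟨ +-‿cancel a r ⟩
      r             ∎
      where
      open ≤-Reasoning
      a = log-seq m n
      b = log-seq m (d ℕ.+ n)
      r = + 1 / suc n

    gap-≤ : ∀ {N i j} → N ℕ.≤ i → i ℕ.≤ j → ∣ log-seq m j - log-seq m i ∣ ≤ + 1 / suc N
    gap-≤ {N} {i} {j} N≤i i≤j = ≤-trans
      (subst (λ k → ∣ log-seq m k - log-seq m i ∣ ≤ + 1 / suc i) (ℕ.m∸n+n≡m i≤j) (gap (j ℕ.∸ i) i))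
      (/-≤ 1 (suc i) 1 (suc N) (ℕ.*-monoʳ-≤ 1 (s≤s N≤i)))

    archimedean : ∀ ε → 0ℚ < ε → ∃ λ N → + 1 / suc N ≤ ε
    archimedean ε@(mkℚ +[1+ p ] d-1 _) _ = d-1 , subst (+ 1 / suc d-1 ≤_) (↥p/↧p≡p ε)
      (/-≤ 1 (suc d-1) (suc p) (suc d-1) (ℕ.*-monoˡ-≤ (suc d-1) {1} {suc p} (s≤s z≤n)))
    archimedean (mkℚ (+ zero) _ _) (*<* (ℤ.+<+ ()))
    archimedean (mkℚ ℤ.-[1+ _ ] _ _) (*<* ())

    log-cauchy : IsCauchy (log-seq m)
    log-cauchy ε 0<ε with N , 1/N≤ε ← archimedean ε 0<ε = N , close
      where
      close : ∀ i j → N ℕ.≤ i → N ℕ.≤ j → ∣ log-seq m i - log-seq m j ∣ ≤ ε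
      close i j N≤i N≤j with ℕ.≤-total i j
      ... | inj₂ j≤i = ≤-trans (gap-≤ N≤j j≤i) 1/N≤ε
      ... | inj₁ i≤j = ≤-trans (≤-reflexive (trans (sym (∣-p∣≡∣p∣ (log-seq m i - log-seq m j)))
          (cong ∣_∣ (neg-swap (log-seq m i) (log-seq m j)))))
        (≤-trans (gap-≤ N≤i i≤j) 1/N≤ε)

  log : ℝ
  log = mkℝ (log-seq m) log-cauchy

{-# OPTIONS --safe #-}
module Submission where

-- For v₁ ≠ v₂ write c ≡ v₁ / v₂ (mod m). The solutions (y₁ , y₂) correspond to the i < L for
-- which c i + b falls into an interval of residues mod m. Cut the range of i into blocks
-- of length q, where |c q - p m| = |ρ| is small (Dirichlet): along a block the points are
-- evenly spread up to O(1), so the discrepancy is O(N / q) ≤ O(m / (q |ρ|)), and the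
-- remainder of the range is treated recursively. This bounds the discrepancy by
-- O(∑ m / (x |y|)) over the points (x , y) with v₁ x ≡ v₂ y (mod m).
-- Exchanging summations, it remains to count the pairs (v₁ , v₂) belonging to a fixed
-- (x , y). Since all v are primes below √m, there are at most 2 gcd (x , m) of them, and
-- gcd (x , m) divides y. Summing over the divisors d of m gives
-- O(m log² m ∑ 1 / d) = O(m² log² m / φ(m)).

open import Data.Nat.Base as ℕ using (ℕ; zero; suc; z≤n; s≤s; NonZero; _^_)
import Data.Nat.Properties as ℕ
open import Data.Nat.Coprimality as Coprime using (Coprime; coprime?; coprime-+; coprime-divisor; coprime-Bézout; coprime⇒gcd≡1; prime⇒coprime)
open import Data.Nat.Primality using (Prime; prime⇒nonZero; prime⇒nonTrivial)
open import Data.Integer.Base as ℤ using (ℤ; +_; 0ℤ)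
import Data.Integer.Properties as ℤ
open import Data.Integer.Tactic.RingSolver using () renaming (solve-∀ to ℤ-solve)
open import Data.List.Base using (List; []; _∷_; _++_; length; lookup; map; filter; applyUpTo; upTo; cartesianProduct)
open import Data.List.Properties using (map-applyUpTo; length-applyUpTo; length-upTo)
open import Data.List.Membership.Propositional using (_∈_)
open import Data.List.Membership.Propositional.Properties using (∈-lookup; ∈-filter⁺; ∈-filter⁻; ∈-applyUpTo⁺; ∈-applyUpTo⁻; ∈-upTo⁺; ∈-upTo⁻; ∈-cartesianProduct⁺; ∈-cartesianProduct⁻)
open import Data.List.Relation.Unary.All as All using (All; _∷_)
open import Data.List.Relation.Unary.AllPairs using (_∷_)
open import Data.List.Relation.Unary.Any using (here; there; index)
open import Data.List.Relation.Unary.Any.Properties using (lookup-index)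
open import Data.List.Relation.Unary.Unique.Propositional using (Unique)
import Data.List.Relation.Unary.Unique.Propositional.Properties as Unique
open import Data.Product.Base using (∃; _×_; _,_; proj₁; proj₂)
open import Data.Sum.Base using (inj₁; inj₂)
open import Relation.Binary.PropositionalEquality hiding (J)
open import Defs

-- The terms |V| L and - |V| L² / m come from the diagonal: for v₁ = v₂ there are exactly L
-- solutions, where the off-diagonal main term would predict L² / m. All estimates up to the
-- comparison with the logarithm are multiplied by m, so that they live in the natural numbers.
-- Blocks give only an upper bound for the number of hits; the lower bound is the upper bound for
-- the complementary interval of residues. The recursion can be charged to a sum over x because the
-- remainder left after blocks of length q is shorter than q: the lengths strictly decrease, and
-- each x is charged at most once. The bound v ≤ √m keeps the products v₁ w₂ and v₂ w₁ of two
-- solution pairs at most m, while gcd considerations make their difference divisible by m / gcd (x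
-- , m); this is the source of the count 2 gcd (x , m). The factor m / φ(m) arises from φ(m) ≤ d φ(m
-- / d) and ∑ φ(m / d) ≤ m, which together give φ(m) ∑ 1 / d ≤ m without any product formula.

module _ where
  open import Algebra.Properties.CommutativeSemigroup ℕ.+-commutativeSemigroup using (interchange)
  open import Data.Fin.Base using (Fin; zero; suc; toℕ; fromℕ<)
  open import Data.Fin.Properties using (injective⇒≤; pigeonhole; toℕ<n; toℕ-fromℕ<)
  open import Data.Integer.Base using (∣_∣)
  open import Data.Integer.DivMod using (_%ℕ_; _/ℕ_; a≡a%ℕn+[a/ℕn]*n)
  open import Data.Integer.Divisibility.Signed as ℤ using (_∣_; _∣?_; divides; ∣⇒∣ᵤ; ∣ᵤ⇒∣)
  open import Data.Nat.Base using (_≤_; _<_; _+_; _*_; _∸_)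
  open import Data.Nat.DivMod using (_/_; _%_; m≡m%n+[m/n]*n; m%n<n; m/n*n≤m; m*n/n≡m; /-monoˡ-≤; m<n*o⇒m/o<n; m<n⇒m%n≡m; [m+n]%n≡m%n; [m+kn]%n≡m%n)
  import Data.Nat.Divisibility as ℕ
  open import Data.Nat.GCD using (module Bézout; gcd; gcd[m,n]∣m; gcd[m,n]∣n; gcd-greatest; c*gcd[m,n]≡gcd[cm,cn])
  open import Data.Nat.Induction using (<-rec)
  open import Data.Nat.Properties using (module ≤-Reasoning)
  open import Data.Nat.Tactic.RingSolver using () renaming (solve-∀ to ℕ-solve)
  open import Data.Unit.Base using (tt)
  open import Function.Base using (_∘_)
  open import Relation.Binary.Definitions using (tri<; tri≈; tri>)
  open import Relation.Nullary using (Dec; yes; no; ¬_; ¬?; contradiction)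
  open import Relation.Unary using (Pred; Decidable)

  private
    variable
      A B : Set
      𝓟 𝓠 : Set

  -- Finite sums over lists, indicators and counting by injections

  ∑ : List A → (A → ℕ) → ℕ
  ∑ []       f = 0
  ∑ (x ∷ xs) f = f x + ∑ xs f

  infixr 6.5 ∑
  syntax ∑ xs (λ x → e) = ∑[ x ∈ xs ] e

  𝟙 : Dec 𝓟 → ℕ
  𝟙 (yes _) = 1
  𝟙 (no  _) = 0

  𝟙-yes : (P? : Dec 𝓟) → 𝓟 → 𝟙 P? ≡ 1
  𝟙-yes (yes _) _ = refl
  𝟙-yes (no ¬p) p = contradiction p ¬p

  𝟙-no : (P? : Dec 𝓟) → ¬ 𝓟 → 𝟙 P? ≡ 0
  𝟙-no (yes p) ¬p = contradiction p ¬p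
  𝟙-no (no _)  _  = refl

  𝟙-≤ : (P? : Dec 𝓟) (Q? : Dec 𝓠) → (𝓟 → 𝓠) → 𝟙 P? ≤ 𝟙 Q?
  𝟙-≤ (yes p) Q? p⇒q = ℕ.≤-reflexive (sym (𝟙-yes Q? (p⇒q p)))
  𝟙-≤ (no _)  Q? p⇒q = z≤n

  𝟙-cong : (P? : Dec 𝓟) (Q? : Dec 𝓠) → (𝓟 → 𝓠) → (𝓠 → 𝓟) → 𝟙 P? ≡ 𝟙 Q?
  𝟙-cong P? Q? p⇒q q⇒p = ℕ.≤-antisym (𝟙-≤ P? Q? p⇒q) (𝟙-≤ Q? P? q⇒p)

  ∑-mono : (xs : List A) {f g : A → ℕ} → (∀ {x} → x ∈ xs → f x ≤ g x) → ∑ xs f ≤ ∑ xs g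
  ∑-mono []       f≤g = z≤n
  ∑-mono (x ∷ xs) f≤g = ℕ.+-mono-≤ (f≤g (here refl)) (∑-mono xs (f≤g ∘ there))

  ∑-cong : (xs : List A) {f g : A → ℕ} → (∀ {x} → x ∈ xs → f x ≡ g x) → ∑ xs f ≡ ∑ xs g
  ∑-cong []       f≡g = refl
  ∑-cong (x ∷ xs) f≡g = cong₂ _+_ (f≡g (here refl)) (∑-cong xs (f≡g ∘ there))

  ∑-+ : (xs : List A) (f g : A → ℕ) → ∑[ x ∈ xs ] (f x + g x) ≡ ∑ xs f + ∑ xs g
  ∑-+ []       f g = refl
  ∑-+ (x ∷ xs) f g = trans (cong (_+_ (f x + g x)) (∑-+ xs f g)) (interchange (f x) (g x) _ _)

  ∑-*ˡ : (xs : List A) (c : ℕ) (f : A → ℕ) → ∑[ x ∈ xs ] (c * f x) ≡ c * ∑ xs f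
  ∑-*ˡ []       c f = sym (ℕ.*-zeroʳ c)
  ∑-*ˡ (x ∷ xs) c f = trans (cong (_+_ (c * f x)) (∑-*ˡ xs c f)) (sym (ℕ.*-distribˡ-+ c (f x) _))

  ∑-*ʳ : (xs : List A) (c : ℕ) (f : A → ℕ) → ∑[ x ∈ xs ] (f x * c) ≡ ∑ xs f * c
  ∑-*ʳ xs c f = trans (∑-cong xs λ {x} _ → ℕ.*-comm (f x) c) (trans (∑-*ˡ xs c f) (ℕ.*-comm c _))

  ∑-const : (xs : List A) (c : ℕ) → ∑[ _ ∈ xs ] c ≡ length xs * c
  ∑-const []       c = refl
  ∑-const (x ∷ xs) c = cong (_+_ c) (∑-const xs c)

  ∑-zero : (xs : List A) → ∑[ _ ∈ xs ] 0 ≡ 0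
  ∑-zero xs = trans (∑-const xs 0) (ℕ.*-zeroʳ (length xs))

  ∑-swap : (xs : List A) (ys : List B) (f : A → B → ℕ) →
    ∑[ x ∈ xs ] ∑[ y ∈ ys ] f x y ≡ ∑[ y ∈ ys ] ∑[ x ∈ xs ] f x y
  ∑-swap []       ys f = sym (∑-zero ys)
  ∑-swap (x ∷ xs) ys f = trans (cong (_+_ (∑ ys (f x))) (∑-swap xs ys f)) (sym (∑-+ ys (f x) _))

  ∑-++ : (xs ys : List A) (f : A → ℕ) → ∑ (xs ++ ys) f ≡ ∑ xs f + ∑ ys f
  ∑-++ []       ys f = refl
  ∑-++ (x ∷ xs) ys f = trans (cong (_+_ (f x)) (∑-++ xs ys f)) (sym (ℕ.+-assoc (f x) _ _))

  ∑-map : (h : A → B) (xs : List A) (f : B → ℕ) → ∑ (map h xs) f ≡ ∑ xs (f ∘ h)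
  ∑-map h []       f = refl
  ∑-map h (x ∷ xs) f = cong (_+_ (f (h x))) (∑-map h xs f)

  ∑-cartesianProduct : (xs : List A) (ys : List B) (f : A × B → ℕ) →
    ∑ (cartesianProduct xs ys) f ≡ ∑[ x ∈ xs ] ∑[ y ∈ ys ] f (x , y)
  ∑-cartesianProduct []       ys f = refl
  ∑-cartesianProduct (x ∷ xs) ys f =
    trans (∑-++ (map (x ,_) ys) _ f) (cong₂ _+_ (∑-map (x ,_) ys f) (∑-cartesianProduct xs ys f))

  length-filter : {P : Pred A _} (P? : Decidable P) (xs : List A) → length (filter P? xs) ≡ ∑[ x ∈ xs ] 𝟙 (P? x)
  length-filter P? [] = refl
  length-filter P? (x ∷ xs) with P? x
  ... | yes _ = cong suc (length-filter P? xs)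
  ... | no  _ = length-filter P? xs

  ∑-filter : {P : Pred A _} (P? : Decidable P) (xs : List A) (f : A → ℕ) →
    ∑ (filter P? xs) f ≡ ∑[ x ∈ xs ] (𝟙 (P? x) * f x)
  ∑-filter P? [] f = refl
  ∑-filter P? (x ∷ xs) f with P? x
  ... | yes _ = cong₂ _+_ (sym (ℕ.*-identityˡ (f x))) (∑-filter P? xs f)
  ... | no  _ = ∑-filter P? xs f

  ≤-∑ : {xs : List A} {x : A} (f : A → ℕ) → x ∈ xs → f x ≤ ∑ xs f
  ≤-∑ f (here refl) = ℕ.m≤m+n _ _
  ≤-∑ f (there x∈)  = ℕ.≤-trans (≤-∑ f x∈) (ℕ.m≤n+m _ _)

  ∑-applyUpTo : (g : ℕ → A) (n : ℕ) (f : A → ℕ) → ∑ (applyUpTo g n) f ≡ ∑[ i ∈ upTo n ] f (g i)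
  ∑-applyUpTo g n f = trans (cong (λ xs → ∑ xs f) (sym (map-applyUpTo (λ i → i) g n))) (∑-map g (upTo n) f)

  ∑-applyUpTo-+ : (g : ℕ → A) (a b : ℕ) (f : A → ℕ) →
    ∑ (applyUpTo g (a + b)) f ≡ ∑ (applyUpTo g a) f + ∑ (applyUpTo (g ∘ (_+_ a)) b) f
  ∑-applyUpTo-+ g zero    b f = refl
  ∑-applyUpTo-+ g (suc a) b f =
    trans (cong (_+_ (f (g 0))) (∑-applyUpTo-+ (g ∘ suc) a b f)) (sym (ℕ.+-assoc (f (g 0)) _ _))

  ∑-upTo-+ : (a b : ℕ) (f : ℕ → ℕ) → ∑ (upTo (a + b)) f ≡ ∑ (upTo a) f + ∑[ i ∈ upTo b ] f (a + i)
  ∑-upTo-+ a b f = trans (∑-applyUpTo-+ (λ i → i) a b f) (cong (_+_ (∑ (upTo a) f)) (∑-applyUpTo (_+_ a) b f))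

  ∑-upTo-suc : (n : ℕ) (f : ℕ → ℕ) → ∑ (upTo (suc n)) f ≡ ∑ (upTo n) f + f n
  ∑-upTo-suc n f = begin
    ∑ (upTo (suc n)) f            ≡⟨ cong (λ k → ∑ (upTo k) f) (ℕ.+-comm 1 n) ⟩
    ∑ (upTo (n + 1)) f            ≡⟨ ∑-upTo-+ n 1 f ⟩
    ∑ (upTo n) f + (f (n + 0) + 0) ≡⟨ cong (_+_ (∑ (upTo n) f)) (trans (ℕ.+-identityʳ _) (cong f (ℕ.+-identityʳ n))) ⟩
    ∑ (upTo n) f + f n            ∎
    where open ≡-Reasoning

  ⟦1⋯_⟧ : ℕ → List ℕ
  ⟦1⋯ n ⟧ = applyUpTo suc n

  ∑-1⋯-suc : (n : ℕ) (f : ℕ → ℕ) → ∑ ⟦1⋯ suc n ⟧ f ≡ ∑ ⟦1⋯ n ⟧ f + f (suc n)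
  ∑-1⋯-suc n f = trans (∑-applyUpTo suc (suc n) f)
    (trans (∑-upTo-suc n (f ∘ suc)) (cong (_+ f (suc n)) (sym (∑-applyUpTo suc n f))))

  ∑-1⋯-mono : {a b : ℕ} (f : ℕ → ℕ) → a ≤ b → ∑ ⟦1⋯ a ⟧ f ≤ ∑ ⟦1⋯ b ⟧ f
  ∑-1⋯-mono {a} {b} f a≤b = begin
    ∑ ⟦1⋯ a ⟧ f              ≤⟨ ℕ.m≤m+n _ _ ⟩
    ∑ ⟦1⋯ a ⟧ f + _          ≡⟨ ∑-applyUpTo-+ suc a (b ∸ a) f ⟨
    ∑ ⟦1⋯ a + (b ∸ a) ⟧ f    ≡⟨ cong (λ k → ∑ ⟦1⋯ k ⟧ f) (ℕ.m+[n∸m]≡n a≤b) ⟩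
    ∑ ⟦1⋯ b ⟧ f              ∎
    where open ≤-Reasoning

  ∈-1⋯⁺ : ∀ {n x} → 1 ≤ x → x ≤ n → x ∈ ⟦1⋯ n ⟧
  ∈-1⋯⁺ {x = suc _} _ x≤n = ∈-applyUpTo⁺ suc x≤n

  ∈-1⋯⁻ : ∀ {n x} → x ∈ ⟦1⋯ n ⟧ → 1 ≤ x × x ≤ n
  ∈-1⋯⁻ x∈ with _ , i<n , refl ← ∈-applyUpTo⁻ suc x∈ = s≤s z≤n , i<n

  1⋯-unique : ∀ n → Unique ⟦1⋯ n ⟧
  1⋯-unique n = Unique.applyUpTo⁺₁ suc n λ i<j _ eq → ℕ.<⇒≢ i<j (ℕ.suc-injective eq)

  lookup-injective : {xs : List A} → Unique xs → ∀ {i j} → lookup xs i ≡ lookup xs j → i ≡ j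
  lookup-injective (_ ∷ _)  {zero}  {zero}  _  = refl
  lookup-injective (x∉ ∷ _) {zero}  {suc j} eq = contradiction eq (All.lookup x∉ (∈-lookup j))
  lookup-injective (x∉ ∷ _) {suc i} {zero}  eq = contradiction (sym eq) (All.lookup x∉ (∈-lookup i))
  lookup-injective (_ ∷ u)  {suc i} {suc j} eq = cong suc (lookup-injective u eq)

  -- Positions in `xs` map injectively to positions in `ys`. Every nontrivial count below is
  -- obtained by finding such a labelling `f`; injectivity is asked only on the members of `xs`.
  length-≤ : {xs : List A} {ys : List B} (f : A → B) → Unique xs → (∀ {x} → x ∈ xs → f x ∈ ys) →
    (∀ {x y} → x ∈ xs → y ∈ xs → f x ≡ f y → x ≡ y) → length xs ≤ length ys
  length-≤ {xs = xs} {ys} f u into inj = injective⇒≤ {f = λ i → index (into (∈-lookup i))} λ {i} {j} eq →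
    lookup-injective u (inj (∈-lookup i) (∈-lookup j)
      (trans (lookup-index (into (∈-lookup i))) (trans (cong (lookup ys) eq) (sym (lookup-index (into (∈-lookup j)))))))

  ∑-𝟙-≤1 : {P : Pred A _} (P? : Decidable P) {xs : List A} → Unique xs →
    (∀ {x y} → x ∈ xs → y ∈ xs → P x → P y → x ≡ y) → ∑[ x ∈ xs ] 𝟙 (P? x) ≤ 1
  ∑-𝟙-≤1 P? {xs} u only = subst (_≤ 1) (length-filter P? xs)
    (length-≤ {ys = tt ∷ []} (λ _ → tt) (Unique.filter⁺ P? u) (λ _ → here refl) λ x∈ y∈ _ →
      let x∈xs , px = ∈-filter⁻ P? {xs = xs} x∈ ; y∈xs , py = ∈-filter⁻ P? {xs = xs} y∈
      in only x∈xs y∈xs px py)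

  ∑-𝟙-≡ : (z n : ℕ) → ∑[ j ∈ upTo n ] 𝟙 (z ℕ.≟ j) ≡ 𝟙 (z ℕ.<? n)
  ∑-𝟙-≡ z n with z ℕ.<? n
  ... | yes z<n = ℕ.≤-antisym (∑-𝟙-≤1 (z ℕ.≟_) (Unique.upTo⁺ n) λ _ _ p q → trans (sym p) q)
    (ℕ.≤-trans (ℕ.≤-reflexive (sym (𝟙-yes (z ℕ.≟ z) refl))) (≤-∑ (λ j → 𝟙 (z ℕ.≟ j)) (∈-upTo⁺ z<n)))
  ... | no z≮n = trans (∑-cong (upTo n) λ {j} j∈ → 𝟙-no (z ℕ.≟ j) λ { refl → z≮n (∈-upTo⁻ j∈) }) (∑-zero (upTo n))

  -- Discrepancy of c i + b modulo m

  pos-*-+ : ∀ a b c → + (a * b + c) ≡ + a ℤ.* + b ℤ.+ + c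
  pos-*-+ a b c = trans (ℤ.pos-+ (a * b) c) (cong (ℤ._+ + c) (ℤ.pos-* a b))

  divMod-ℤ : ∀ a m .{{_ : NonZero m}} → + a ≡ + (a / m) ℤ.* + m ℤ.+ + (a % m)
  divMod-ℤ a m = trans (cong +_ (trans (m≡m%n+[m/n]*n a m) (ℕ.+-comm (a % m) _))) (pos-*-+ (a / m) m (a % m))

  small-multiple : ∀ {m z} → + m ∣ z → ∣ z ∣ < m → z ≡ 0ℤ
  small-multiple {m} {z} m∣z ∣z∣<m with ∣ z ∣ in eq | ∣⇒∣ᵤ m∣z
  ... | zero  | _  = ℤ.∣i∣≡0⇒i≡0 eq
  ... | suc _ | m∣ = contradiction ∣z∣<m (ℕ.≤⇒≯ (ℕ.∣⇒≤ m∣))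

  ∣x-y∣<m : ∀ {x y m} → x < m → y < m → ∣ + x ℤ.- + y ∣ < m
  ∣x-y∣<m {x} {y} {m} x<m y<m = begin-strict
    ∣ + x ℤ.- + y ∣  ≡⟨ cong ∣_∣ (ℤ.m-n≡m⊖n x y) ⟩
    ∣ x ℤ.⊖ y ∣      ≤⟨ ℤ.∣m⊝n∣≤m⊔n x y ⟩
    x ℕ.⊔ y          <⟨ ℕ.⊔-lub x<m y<m ⟩
    m                ∎
    where open ≤-Reasoning

  residue-unique : ∀ {m x y} → x < m → y < m → + m ∣ + x ℤ.- + y → x ≡ y
  residue-unique x<m y<m m∣ = ℤ.+-injective (ℤ.i-j≡0⇒i≡j _ _ (small-multiple m∣ (∣x-y∣<m x<m y<m)))

  -- Combined with `small-multiple`, this makes the quotient by m an injective label on the numbers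
  -- of a single residue class mod m.
  same-quotient : ∀ {a b m} .{{_ : NonZero m}} → a / m ≡ b / m → ∣ + a ℤ.- + b ∣ < m
  same-quotient {a} {b} {m} eq = subst (λ z → ∣ z ∣ < m) (sym (begin
    + a ℤ.- + b                                                  ≡⟨ cong₂ ℤ._-_ (divMod-ℤ a m) (divMod-ℤ b m) ⟩
    + (a / m) ℤ.* + m ℤ.+ + (a % m) ℤ.- (+ (b / m) ℤ.* + m ℤ.+ + (b % m)) ≡⟨ cong (λ k → k ℤ.* + m ℤ.+ + (a % m) ℤ.- (+ (b / m) ℤ.* + m ℤ.+ + (b % m))) (cong +_ eq) ⟩
    + (b / m) ℤ.* + m ℤ.+ + (a % m) ℤ.- (+ (b / m) ℤ.* + m ℤ.+ + (b % m)) ≡⟨ cancel (+ (b / m) ℤ.* + m) (+ (a % m)) (+ (b % m)) ⟩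
    + (a % m) ℤ.- + (b % m)                                      ∎)) (∣x-y∣<m (m%n<n a m) (m%n<n b m))
    where
    open ≡-Reasoning
    cancel : ∀ k x y → k ℤ.+ x ℤ.- (k ℤ.+ y) ≡ x ℤ.- y
    cancel = ℤ-solve

  gcd-split : ∀ a b .{{_ : NonZero b}} → ∃ λ d → ∃ λ a′ → ∃ λ b′ → a ≡ a′ * d × b ≡ b′ * d × Coprime b′ a′
  gcd-split a b with gcd[m,n]∣m a b | gcd[m,n]∣n a b
  ... | ℕ.divides a′ a≡ | ℕ.divides b′ b≡ = gcd a b , a′ , b′ , a≡ , b≡ , coprime
    where
    instance
      d≢0 : NonZero (gcd a b)
      d≢0 = ℕ.≢-nonZero λ d≡0 → ℕ.≢-nonZero⁻¹ b (trans b≡ (trans (cong (b′ *_) d≡0) (ℕ.*-zeroʳ b′)))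
    coprime : Coprime b′ a′
    coprime {k} (k∣b′ , k∣a′) = ℕ.∣1⇒≡1 (ℕ.*-cancelʳ-∣ (gcd a b) (subst (k * gcd a b ℕ.∣_) (sym (ℕ.*-identityˡ _))
      (gcd-greatest (subst (k * gcd a b ℕ.∣_) (sym a≡) (ℕ.*-monoˡ-∣ (gcd a b) k∣a′))
                    (subst (k * gcd a b ℕ.∣_) (sym b≡) (ℕ.*-monoˡ-∣ (gcd a b) k∣b′)))))

  -- The constant `K` keeps K - ρ i natural along the whole block for either sign of ρ: it is q ρ
  -- for ρ ≥ 0 and 0 for ρ < 0.
  drift : ∀ q ρ → ∃ λ (s : ℕ → ℕ) → ∃ λ K →
    (∀ i → i < q → + s i ≡ K ℤ.- ρ ℤ.* + i) × (∀ i → i < q → s i ≤ q * ∣ ρ ∣)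
  drift q (+ r) = (λ i → (q ∸ i) * r) , + q ℤ.* + r ,
    (λ i i<q → begin
      + ((q ∸ i) * r)             ≡⟨ ℤ.pos-* (q ∸ i) r ⟩
      + (q ∸ i) ℤ.* + r           ≡⟨ cong (ℤ._* + r) (trans (sym (ℤ.⊖-≥ (ℕ.<⇒≤ i<q))) (sym (ℤ.m-n≡m⊖n q i))) ⟩
      (+ q ℤ.- + i) ℤ.* + r       ≡⟨ ring (+ q) (+ i) (+ r) ⟩
      + q ℤ.* + r ℤ.- + r ℤ.* + i ∎) ,
    λ i _ → ℕ.*-monoˡ-≤ r (ℕ.m∸n≤m q i)
    where
    open ≡-Reasoning
    ring : ∀ q i r → (q ℤ.- i) ℤ.* r ≡ q ℤ.* r ℤ.- r ℤ.* i
    ring = ℤ-solve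
  drift q ℤ.-[1+ r ] = (λ i → suc r * i) , 0ℤ ,
    (λ i _ → trans (ℤ.pos-* (suc r) i) (ring (+ suc r) (+ i))) ,
    λ i i<q → subst (suc r * i ≤_) (ℕ.*-comm (suc r) q) (ℕ.*-monoʳ-≤ (suc r) (ℕ.<⇒≤ i<q))
    where
    ring : ∀ r i → r ℤ.* i ≡ 0ℤ ℤ.- (ℤ.- r) ℤ.* i
    ring = ℤ-solve

  module _ {m c q p : ℕ} {ρ : ℤ} .{{_ : NonZero m}}
           (q⊥p : Coprime q p) (cq≡pm+ρ : + c ℤ.* + q ≡ + p ℤ.* + m ℤ.+ ρ) where


    -- A hit has q y + s ≤ q H + m, and the quotient of q y + s by m labels it uniquely. Of the
    -- excess 2 m, one m pays for the drift `s` and one for the label 0.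
    block-shifted : ∀ b H (s : ℕ → ℕ) K → (∀ i → i < q → + s i ≡ K ℤ.- ρ ℤ.* + i) → (∀ i → i < q → s i ≤ m) →
      m * (∑[ i ∈ upTo q ] 𝟙 ((c * i + b) % m ℕ.<? H)) ≤ q * H + 2 * m
    block-shifted b H s K s≡ s≤m = let open ≤-Reasoning in begin
      m * (∑[ i ∈ upTo q ] 𝟙 (y i ℕ.<? H))   ≡⟨ cong (m *_) (length-filter (λ i → y i ℕ.<? H) (upTo q)) ⟨
      m * length xs                          ≤⟨ ℕ.*-monoʳ-≤ m (length-≤ {ys = upTo (suc ((q * H + m) / m))} (λ i → z i / m) (Unique.filter⁺ (λ i → y i ℕ.<? H) (Unique.upTo⁺ q)) into inj) ⟩
      m * length (upTo (suc ((q * H + m) / m))) ≡⟨ cong (m *_) (length-upTo _) ⟩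
      m * suc ((q * H + m) / m)              ≡⟨ ℕ.*-suc m _ ⟩
      m + m * ((q * H + m) / m)              ≡⟨ cong (_+_ m) (ℕ.*-comm m _) ⟩
      m + (q * H + m) / m * m                ≤⟨ ℕ.+-monoʳ-≤ m (m/n*n≤m (q * H + m) m) ⟩
      m + (q * H + m)                        ≡⟨ rearrange m (q * H) ⟩
      q * H + 2 * m                          ∎
      where
      rearrange : ∀ m k → m + (k + m) ≡ k + 2 * m
      rearrange = ℕ-solve

      u y z : ℕ → ℕ
      u i = (c * i + b) / m
      y i = (c * i + b) % m
      z i = q * y i + s i

      xs = filter (λ i → y i ℕ.<? H) (upTo q)

      ∈xs : ∀ {i} → i ∈ xs → i < q × y i < H
      ∈xs i∈ = let i∈q , yi<H = ∈-filter⁻ (λ i → y i ℕ.<? H) {xs = upTo q} i∈ in ∈-upTo⁻ i∈q , yi<H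

      into : ∀ {i} → i ∈ xs → z i / m ∈ upTo (suc ((q * H + m) / m))
      into i∈ = let i<q , yi<H = ∈xs i∈ in
        ∈-upTo⁺ (s≤s (/-monoˡ-≤ m (ℕ.+-mono-≤ (ℕ.*-monoʳ-≤ q (ℕ.<⇒≤ yi<H)) (s≤m _ i<q))))

      y≡ : ∀ i → + y i ≡ + c ℤ.* + i ℤ.+ + b ℤ.- + u i ℤ.* + m
      y≡ i = begin
        + y i                                                    ≡⟨ cancel (+ y i) (+ u i ℤ.* + m) ⟩
        + u i ℤ.* + m ℤ.+ + y i ℤ.- + u i ℤ.* + m                ≡⟨ cong (ℤ._- + u i ℤ.* + m) (divMod-ℤ (c * i + b) m) ⟨
        + (c * i + b) ℤ.- + u i ℤ.* + m                          ≡⟨ cong (ℤ._- + u i ℤ.* + m) (pos-*-+ c i b) ⟩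
        + c ℤ.* + i ℤ.+ + b ℤ.- + u i ℤ.* + m                    ∎
        where
        open ≡-Reasoning
        cancel : ∀ y k → y ≡ k ℤ.+ y ℤ.- k
        cancel = ℤ-solve

      ρ≡ : ρ ≡ + c ℤ.* + q ℤ.- + p ℤ.* + m
      ρ≡ = trans (cancel ρ (+ p ℤ.* + m)) (cong (ℤ._- + p ℤ.* + m) (sym cq≡pm+ρ))
        where
        cancel : ∀ y k → y ≡ k ℤ.+ y ℤ.- k
        cancel = ℤ-solve

      z≡ : ∀ {i} → i < q → + z i ≡ + m ℤ.* (+ p ℤ.* + i ℤ.- + q ℤ.* + u i) ℤ.+ (+ q ℤ.* + b ℤ.+ K)
      z≡ {i} i<q = begin
        + z i                                                    ≡⟨ pos-*-+ q (y i) (s i) ⟩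
        + q ℤ.* + y i ℤ.+ + s i                                  ≡⟨ cong₂ (λ y s → + q ℤ.* y ℤ.+ s) (y≡ i) (trans (s≡ i i<q) (cong (λ ρ → K ℤ.- ρ ℤ.* + i) ρ≡)) ⟩
        + q ℤ.* (+ c ℤ.* + i ℤ.+ + b ℤ.- + u i ℤ.* + m) ℤ.+ (K ℤ.- (+ c ℤ.* + q ℤ.- + p ℤ.* + m) ℤ.* + i)  ≡⟨ ring (+ q) (+ c) (+ i) (+ b) (+ u i) (+ m) K (+ p) ⟩
        + m ℤ.* (+ p ℤ.* + i ℤ.- + q ℤ.* + u i) ℤ.+ (+ q ℤ.* + b ℤ.+ K)  ∎
        where
        open ≡-Reasoning
        ring : ∀ q c i b u m K p → q ℤ.* (c ℤ.* i ℤ.+ b ℤ.- u ℤ.* m) ℤ.+ (K ℤ.- (c ℤ.* q ℤ.- p ℤ.* m) ℤ.* i)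
          ≡ m ℤ.* (p ℤ.* i ℤ.- q ℤ.* u) ℤ.+ (q ℤ.* b ℤ.+ K)
        ring = ℤ-solve

      -- All `z i` lie in one class mod m, so equal quotients force z i = z j. Dividing by m leaves
      -- p (i - j) divisible by q, and p is invertible mod q.
      inj : ∀ {i j} → i ∈ xs → j ∈ xs → z i / m ≡ z j / m → i ≡ j
      inj {i} {j} i∈ j∈ eq = residue-unique i<q j<q (∣ᵤ⇒∣ (coprime-divisor q⊥p
          (subst (q ℕ.∣_) (ℤ.abs-* (+ p) (+ i ℤ.- + j)) (∣⇒∣ᵤ q∣))))
        where
        i<q = proj₁ (∈xs i∈)
        j<q = proj₁ (∈xs j∈)
        t = + p ℤ.* (+ i ℤ.- + j) ℤ.- + q ℤ.* (+ u i ℤ.- + u j)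
        ring : ∀ m p i j q u v e → m ℤ.* (p ℤ.* i ℤ.- q ℤ.* u) ℤ.+ e ℤ.- (m ℤ.* (p ℤ.* j ℤ.- q ℤ.* v) ℤ.+ e)
          ≡ (p ℤ.* (i ℤ.- j) ℤ.- q ℤ.* (u ℤ.- v)) ℤ.* m
        ring = ℤ-solve
        zi-zj : + z i ℤ.- + z j ≡ t ℤ.* + m
        zi-zj = trans (cong₂ ℤ._-_ (z≡ i<q) (z≡ j<q)) (ring (+ m) (+ p) (+ i) (+ j) (+ q) (+ u i) (+ u j) _)
        t≡0 : t ≡ 0ℤ
        t≡0 = ℤ.*-cancelʳ-≡ t 0ℤ (+ m) (trans (sym zi-zj)
          (small-multiple (divides t zi-zj) (same-quotient {z i} {z j} eq)))
        q∣ : + q ∣ + p ℤ.* (+ i ℤ.- + j)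
        q∣ = divides (+ u i ℤ.- + u j) (trans (ℤ.i-j≡0⇒i≡j _ _ t≡0) (ℤ.*-comm (+ q) _))

    -- Subtracting the drift ρ i from q y, where y is the residue of c i + b, turns the
    -- residues of a block into distinct integers of one class mod m.
    block : q * ∣ ρ ∣ ≤ m → ∀ b H →
      m * (∑[ i ∈ upTo q ] 𝟙 ((c * i + b) % m ℕ.<? H)) ≤ q * H + 2 * m
    block qρ≤m b H with s , K , s≡ , s≤ ← drift q ρ =
      block-shifted b H s K s≡ λ i i<q → ℕ.≤-trans (s≤ i i<q) qρ≤m

  -- Dirichlet approximation of c / m

  Approximation : (c m N : ℕ) → Set
  Approximation c m N = ∃ λ q → ∃ λ p → ∃ λ ρ →
    0 < q × q ≤ N × Coprime q p × + c ℤ.* + q ≡ + p ℤ.* + m ℤ.+ ρ × ∣ ρ ∣ * N < m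

  -- Among the N + 1 residues of c t for 0 ≤ t ≤ N, two share one of N buckets of width m / N; their
  -- difference gives q and ρ.
  dirichlet : ∀ c m N .{{_ : NonZero m}} → 0 < N → Approximation c m N
  dirichlet c m N 0<N = reduce (pigeonhole (ℕ.n<1+n N) bucket)
    where
    bucket : Fin (suc N) → Fin N
    bucket t = fromℕ< {N * (c * toℕ t % m) / m} (m<n*o⇒m/o<n (ℕ.*-monoʳ-< N {{ℕ.>-nonZero 0<N}} (m%n<n (c * toℕ t) m)))

    reduce : (∃ λ i → ∃ λ j → toℕ i < toℕ j × bucket i ≡ bucket j) → Approximation c m N
    reduce (i , j , i<j , same) = q , p , ρ , 0<q , q≤N , q⊥p , ρ-def , ∣ρ∣N<m
      where
      t t′ q₀ u u′ x x′ p₀ : ℕ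
      t  = toℕ i
      t′ = toℕ j
      q₀ = t′ ∸ t
      u  = c * t / m
      u′ = c * t′ / m
      p₀ = u′ ∸ u
      x  = c * t % m
      x′ = c * t′ % m
      u≤u′ : u ≤ u′
      u≤u′ = /-monoˡ-≤ m (ℕ.*-monoʳ-≤ c (ℕ.<⇒≤ i<j))
      0<q₀ : 0 < q₀
      0<q₀ = ℕ.m<n⇒0<n∸m i<j
      ρ₀ = + x′ ℤ.- + x

      ∸-ℤ : ∀ {a b} → a ≤ b → + (b ∸ a) ≡ + b ℤ.- + a
      ∸-ℤ {a} {b} a≤b = trans (sym (ℤ.⊖-≥ a≤b)) (sym (ℤ.m-n≡m⊖n b a))

      ρ₀-def : ρ₀ ≡ + c ℤ.* + q₀ ℤ.- + p₀ ℤ.* + m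
      ρ₀-def = begin
        + x′ ℤ.- + x
          ≡⟨ ring (+ x) (+ x′) (+ u) (+ u′) (+ m) ⟩
        (+ u′ ℤ.* + m ℤ.+ + x′) ℤ.- (+ u ℤ.* + m ℤ.+ + x) ℤ.- (+ u′ ℤ.- + u) ℤ.* + m
          ≡⟨ cong₂ (λ a b → a ℤ.- b ℤ.- (+ u′ ℤ.- + u) ℤ.* + m)
               (trans (sym (divMod-ℤ (c * t′) m)) (ℤ.pos-* c t′)) (trans (sym (divMod-ℤ (c * t) m)) (ℤ.pos-* c t)) ⟩
        + c ℤ.* + t′ ℤ.- + c ℤ.* + t ℤ.- (+ u′ ℤ.- + u) ℤ.* + m
          ≡⟨ ring′ (+ c) (+ t) (+ t′) ((+ u′ ℤ.- + u) ℤ.* + m) ⟩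
        + c ℤ.* (+ t′ ℤ.- + t) ℤ.- (+ u′ ℤ.- + u) ℤ.* + m
          ≡⟨ cong₂ (λ a b → + c ℤ.* a ℤ.- b ℤ.* + m) (∸-ℤ (ℕ.<⇒≤ i<j)) (∸-ℤ u≤u′) ⟨
        + c ℤ.* + q₀ ℤ.- + p₀ ℤ.* + m ∎
        where
        open ≡-Reasoning
        ring : ∀ x y u v m → y ℤ.- x ≡ (v ℤ.* m ℤ.+ y) ℤ.- (u ℤ.* m ℤ.+ x) ℤ.- (v ℤ.- u) ℤ.* m
        ring = ℤ-solve
        ring′ : ∀ c s t k → c ℤ.* t ℤ.- c ℤ.* s ℤ.- k ≡ c ℤ.* (t ℤ.- s) ℤ.- k
        ring′ = ℤ-solve

      ∣ρ₀∣N<m : ∣ ρ₀ ∣ * N < m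
      ∣ρ₀∣N<m = subst (_< m) (begin
        ∣ + (N * x′) ℤ.- + (N * x) ∣          ≡⟨ cong₂ (λ a b → ∣ a ℤ.- b ∣) (ℤ.pos-* N x′) (ℤ.pos-* N x) ⟩
        ∣ + N ℤ.* + x′ ℤ.- + N ℤ.* + x ∣      ≡⟨ cong ∣_∣ (ring (+ N) (+ x′) (+ x)) ⟩
        ∣ ρ₀ ℤ.* + N ∣                        ≡⟨ ℤ.abs-* ρ₀ (+ N) ⟩
        ∣ ρ₀ ∣ * N                            ∎)
        (same-quotient {N * x′} {N * x} (sym (trans (sym (toℕ-fromℕ< _)) (trans (cong toℕ same) (toℕ-fromℕ< _)))))
        where
        open ≡-Reasoning
        ring : ∀ n x y → n ℤ.* x ℤ.- n ℤ.* y ≡ (x ℤ.- y) ℤ.* n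
        ring = ℤ-solve

      -- The block estimate requires q and p coprime. Passing to lowest terms divides the error ρ₀
      -- by d as well, so the bound on it survives.
      split = gcd-split p₀ q₀ {{ℕ.>-nonZero 0<q₀}}
      d = proj₁ split
      p = proj₁ (proj₂ split)
      q = proj₁ (proj₂ (proj₂ split))
      p₀≡pd : p₀ ≡ p * d
      p₀≡pd = proj₁ (proj₂ (proj₂ (proj₂ split)))
      q₀≡qd : q₀ ≡ q * d
      q₀≡qd = proj₁ (proj₂ (proj₂ (proj₂ (proj₂ split))))
      q⊥p : Coprime q p
      q⊥p = proj₂ (proj₂ (proj₂ (proj₂ (proj₂ split))))
      instance
        qd≢0 : NonZero (q * d)
        qd≢0 = ℕ.>-nonZero (subst (0 <_) q₀≡qd 0<q₀)
        d≢0 : NonZero d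
        d≢0 = ℕ.m*n≢0⇒n≢0 q
      0<q = ℕ.>-nonZero⁻¹ q {{ℕ.m*n≢0⇒m≢0 q}}

      q≤N : q ≤ N
      q≤N = begin
        q       ≤⟨ ℕ.m≤m*n q d ⟩
        q * d   ≡⟨ q₀≡qd ⟨
        t′ ∸ t  ≤⟨ ℕ.m∸n≤m t′ t ⟩
        t′      ≤⟨ ℕ.≤-pred (toℕ<n j) ⟩
        N       ∎
        where open ≤-Reasoning

      ρ = + c ℤ.* + q ℤ.- + p ℤ.* + m
      ρ-def : + c ℤ.* + q ≡ + p ℤ.* + m ℤ.+ ρ
      ρ-def = ring (+ c ℤ.* + q) (+ p ℤ.* + m)
        where
        ring : ∀ a b → a ≡ b ℤ.+ (a ℤ.- b)
        ring = ℤ-solve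

      ρ₀≡ρd : ρ₀ ≡ ρ ℤ.* + d
      ρ₀≡ρd = begin
        ρ₀                                                  ≡⟨ ρ₀-def ⟩
        + c ℤ.* + q₀ ℤ.- + p₀ ℤ.* + m                       ≡⟨ cong₂ (λ a b → + c ℤ.* a ℤ.- b ℤ.* + m) (trans (cong +_ q₀≡qd) (ℤ.pos-* q d)) (trans (cong +_ p₀≡pd) (ℤ.pos-* p d)) ⟩
        + c ℤ.* (+ q ℤ.* + d) ℤ.- + p ℤ.* + d ℤ.* + m       ≡⟨ ring (+ c) (+ q) (+ d) (+ p) (+ m) ⟩
        ρ ℤ.* + d                                           ∎
        where
        open ≡-Reasoning
        ring : ∀ c q d p m → c ℤ.* (q ℤ.* d) ℤ.- p ℤ.* d ℤ.* m ≡ (c ℤ.* q ℤ.- p ℤ.* m) ℤ.* d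
        ring = ℤ-solve

      ∣ρ∣N<m : ∣ ρ ∣ * N < m
      ∣ρ∣N<m = ℕ.≤-<-trans (ℕ.*-monoˡ-≤ N (subst (∣ ρ ∣ ≤_)
        (trans (sym (ℤ.abs-* ρ (+ d))) (cong ∣_∣ (sym ρ₀≡ρd))) (ℕ.m≤m*n ∣ ρ ∣ d))) ∣ρ₀∣N<m

  -- Total quotients, and hits of an interval of residues

  infixl 7 _÷_

  -- The value 0 at divisor 0 keeps a ÷ n * n ≤ a unconditional, so quotients can stand in sums
  -- without instance arguments.
  _÷_ : ℕ → ℕ → ℕ
  a ÷ zero    = 0
  a ÷ (suc n) = a / suc n

  ÷-*-≤ : ∀ a n → a ÷ n * n ≤ a
  ÷-*-≤ a zero    = z≤n
  ÷-*-≤ a (suc n) = m/n*n≤m a (suc n)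

  ≤-÷ : ∀ {k a n} → 0 < n → k * n ≤ a → k ≤ a ÷ n
  ≤-÷ {k} {a} {suc n} _ kn≤a = subst (_≤ a / suc n) (m*n/n≡m k (suc n)) (/-monoˡ-≤ (suc n) kn≤a)

  hits : ∀ (m c b N H : ℕ) .{{_ : NonZero m}} → ℕ
  hits m c b N H = ∑[ i ∈ upTo N ] 𝟙 ((c * i + b) % m ℕ.<? H)

  hits-+ : ∀ m c b a N H .{{_ : NonZero m}} → hits m c b (a + N) H ≡ hits m c b a H + hits m c (c * a + b) N H
  hits-+ m c b a N H = trans (∑-upTo-+ a N _) (cong (_+_ (hits m c b a H))
    (∑-cong (upTo N) λ {i} _ → cong (λ k → 𝟙 (k % m ℕ.<? H)) (ring c a i b)))
    where
    ring : ∀ c a i b → c * (a + i) + b ≡ c * i + (c * a + b)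
    ring = ℕ-solve

  shift-% : ∀ x y m .{{_ : NonZero m}} → (x + y) % m ≡ (x % m + y) % m
  shift-% x y m = begin
    (x + y) % m                          ≡⟨ cong (λ x → (x + y) % m) (m≡m%n+[m/n]*n x m) ⟩
    (x % m + x / m * m + y) % m          ≡⟨ cong (_% m) (ring (x % m) (x / m * m) y) ⟩
    (x % m + y + x / m * m) % m          ≡⟨ [m+kn]%n≡m%n (x % m + y) (x / m) m ⟩
    (x % m + y) % m                      ∎
    where
    open ≡-Reasoning
    ring : ∀ a b c → a + b + c ≡ a + c + b
    ring = ℕ-solve

  -- Translation by m - H carries the residues H, ..., m - 1 onto 0, ..., m - H - 1, so missing one
  -- initial interval amounts to hitting another.
  𝟙-complement : ∀ {m H} .{{_ : NonZero m}} → H ≤ m → ∀ x → 𝟙 (x % m ℕ.<? H) + 𝟙 ((x + (m ∸ H)) % m ℕ.<? m ∸ H) ≡ 1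
  𝟙-complement {m} {H} H≤m x with x % m ℕ.<? H
  ... | yes r<H = cong suc (𝟙-no (_ ℕ.<? _) (ℕ.≤⇒≯ (subst (m ∸ H ≤_) (sym no-wrap) (ℕ.m≤n+m (m ∸ H) (x % m)))))
    where
    no-wrap : (x + (m ∸ H)) % m ≡ x % m + (m ∸ H)
    no-wrap = trans (shift-% x (m ∸ H) m) (m<n⇒m%n≡m (subst (x % m + (m ∸ H) <_) (ℕ.m+[n∸m]≡n H≤m) (ℕ.+-monoˡ-< (m ∸ H) r<H)))
  ... | no r≮H = 𝟙-yes (_ ℕ.<? _) (subst (_< m ∸ H) (sym wrap) (ℕ.∸-monoˡ-< (m%n<n x m) H≤r))
    where
    H≤r = ℕ.≮⇒≥ r≮H
    wrap : (x + (m ∸ H)) % m ≡ x % m ∸ H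
    wrap = begin
      (x + (m ∸ H)) % m            ≡⟨ shift-% x (m ∸ H) m ⟩
      (x % m + (m ∸ H)) % m        ≡⟨ cong (λ r → (r + (m ∸ H)) % m) (ℕ.m∸n+n≡m H≤r) ⟨
      (x % m ∸ H + H + (m ∸ H)) % m ≡⟨ cong (_% m) (trans (ℕ.+-assoc (x % m ∸ H) H (m ∸ H)) (cong (_+_ (x % m ∸ H)) (ℕ.m+[n∸m]≡n H≤m))) ⟩
      (x % m ∸ H + m) % m          ≡⟨ [m+n]%n≡m%n (x % m ∸ H) m ⟩
      (x % m ∸ H) % m              ≡⟨ m<n⇒m%n≡m (ℕ.≤-<-trans (ℕ.m∸n≤m (x % m) H) (m%n<n x m)) ⟩
      x % m ∸ H                    ∎
      where open ≡-Reasoning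

  hits-complement : ∀ {m H} .{{_ : NonZero m}} → H ≤ m → ∀ c b N → hits m c b N H + hits m c (b + (m ∸ H)) N (m ∸ H) ≡ N
  hits-complement {m} {H} H≤m c b N = begin
    hits m c b N H + hits m c (b + (m ∸ H)) N (m ∸ H)   ≡⟨ ∑-+ (upTo N) _ _ ⟨
    ∑[ i ∈ upTo N ] (𝟙 ((c * i + b) % m ℕ.<? H) + 𝟙 ((c * i + (b + (m ∸ H))) % m ℕ.<? m ∸ H))
      ≡⟨ ∑-cong (upTo N) (λ {i} _ → trans (cong (λ y → 𝟙 ((c * i + b) % m ℕ.<? H) + 𝟙 (y % m ℕ.<? m ∸ H)) (sym (ℕ.+-assoc (c * i) b (m ∸ H))))
           (𝟙-complement H≤m (c * i + b))) ⟩
    ∑[ i ∈ upTo N ] 1                                   ≡⟨ ∑-const (upTo N) 1 ⟩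
    length (upTo N) * 1                                 ≡⟨ ℕ.*-identityʳ _ ⟩
    length (upTo N)                                     ≡⟨ length-upTo N ⟩
    N                                                   ∎
    where open ≡-Reasoning

  -- Cutting off a block only changes the offset b to c q + b; bounds uniform in the offset
  -- therefore add up.
  hits-blocks : ∀ {m c q N H X Y} .{{_ : NonZero m}} → (∀ b → m * hits m c b q H ≤ X) →
    (∀ b → m * hits m c b N H ≤ Y) → ∀ k b → m * hits m c b (k * q + N) H ≤ k * X + Y
  hits-blocks _ rest zero b = rest b
  hits-blocks {m} {c} {q} {N} {H} {X} {Y} blk rest (suc k) b = begin
    m * hits m c b (q + k * q + N) H    ≡⟨ cong (λ n → m * hits m c b n H) (ℕ.+-assoc q (k * q) N) ⟩
    m * hits m c b (q + (k * q + N)) H  ≡⟨ cong (m *_) (hits-+ m c b q (k * q + N) H) ⟩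
    m * (hits m c b q H + hits m c (c * q + b) (k * q + N) H)  ≡⟨ ℕ.*-distribˡ-+ m _ _ ⟩
    m * hits m c b q H + m * hits m c (c * q + b) (k * q + N) H
      ≤⟨ ℕ.+-mono-≤ (blk b) (hits-blocks {c = c} blk rest k (c * q + b)) ⟩
    X + (k * X + Y)                     ≡⟨ ℕ.+-assoc X (k * X) Y ⟨
    X + k * X + Y                       ∎
    where open ≤-Reasoning

  -- The weight `w` x dominates m / (x |ρ|) for every admissible ρ ≡ c x. Keeping it abstract
  -- separates the recursion from the later description of ρ by v₁ and v₂.
  module _ {m c : ℕ} .{{_ : NonZero m}} (c-unit : ∀ {x} → + m ∣ + c ℤ.* + x → m ℕ.∣ x)
           (w : ℕ → ℕ) (w≥ : ∀ {q ρ} → 0 < q → 0 < ∣ ρ ∣ → ∣ ρ ∣ ≤ m → + m ∣ + c ℤ.* + q ℤ.- ρ → m ÷ (q * ∣ ρ ∣) ≤ w q) where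

    private
      cost : ℕ → ℕ
      cost N = ∑ ⟦1⋯ N ⟧ w

      Bounded : ℕ → Set
      Bounded N = N < m → ∀ H b → m * hits m c b N H ≤ N * H + 2 * m * cost N

      step′ : ∀ N → 0 < N → (∀ {N′} → N′ < N → Bounded N′) → N < m → ∀ H b → Approximation c m N →
        m * hits m c b N H ≤ N * H + 2 * m * cost N
      step′ N 0<N rec N<m H b (q , p , ρ , 0<q , q≤N , q⊥p , cq≡ , ρN<m) = begin
        m * hits m c b N H                     ≡⟨ cong (λ n → m * hits m c b n H) N≡ ⟩
        m * hits m c b (k * q + N′) H
          ≤⟨ hits-blocks {c = c} (λ b → block {c = c} q⊥p cq≡ qρ≤m b H) (rec (ℕ.<-≤-trans N′<q q≤N) (ℕ.<-trans (ℕ.<-≤-trans N′<q q≤N) N<m) H) k b ⟩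
        k * (q * H + 2 * m) + (N′ * H + 2 * m * cost N′)   ≡⟨ ring k q H m N′ (cost N′) ⟩
        (k * q + N′) * H + 2 * m * (cost N′ + k)           ≤⟨ ℕ.+-monoʳ-≤ _ (ℕ.*-monoʳ-≤ (2 * m) cost≤) ⟩
        (k * q + N′) * H + 2 * m * cost N                  ≡⟨ cong (λ n → n * H + 2 * m * cost N) N≡ ⟨
        N * H + 2 * m * cost N                 ∎
        where
        open ≤-Reasoning
        instance
          q≢0 = ℕ.>-nonZero 0<q
          N≢0 = ℕ.>-nonZero 0<N
        k N′ : ℕ
        k  = N / q
        N′ = N % q
        N′<q : N′ < q
        N′<q = m%n<n N q
        N≡ : N ≡ k * q + N′
        N≡ = trans (m≡m%n+[m/n]*n N q) (ℕ.+-comm N′ _)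
        qρ≤m : q * ∣ ρ ∣ ≤ m
        qρ≤m = ℕ.<⇒≤ (ℕ.≤-<-trans (ℕ.≤-trans (ℕ.*-monoˡ-≤ ∣ ρ ∣ q≤N) (ℕ.≤-reflexive (ℕ.*-comm N ∣ ρ ∣))) ρN<m)
        ring : ∀ k q H m n s → k * (q * H + 2 * m) + (n * H + 2 * m * s) ≡ (k * q + n) * H + 2 * m * (s + k)
        ring = ℕ-solve
        m∣cq-ρ : + m ∣ + c ℤ.* + q ℤ.- ρ
        m∣cq-ρ = divides (+ p) (trans (cong (ℤ._- ρ) cq≡) (cancel (+ p ℤ.* + m) ρ))
          where
          cancel : ∀ a b → a ℤ.+ b ℤ.- b ≡ a
          cancel = ℤ-solve
        -- If ρ vanished, m would divide c q and hence q, as c is a unit; but 0 < q ≤ N < m.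
        0<∣ρ∣ : 0 < ∣ ρ ∣
        0<∣ρ∣ = ℕ.n≢0⇒n>0 λ ∣ρ∣≡0 → ℕ.<⇒≱ (ℕ.≤-<-trans q≤N N<m) (ℕ.∣⇒≤ (c-unit
          (subst (+ m ∣_) (trans (cong (λ z → + c ℤ.* + q ℤ.- z) (ℤ.∣i∣≡0⇒i≡0 ∣ρ∣≡0)) (ℤ.+-identityʳ _)) m∣cq-ρ)))
        -- The number of blocks is at most N / q, and Dirichlet gives N < m / |ρ|.
        k≤w : k ≤ w q
        k≤w = ℕ.≤-trans (≤-÷ (ℕ.*-mono-≤ {1} {q} {1} 0<q 0<∣ρ∣) (begin
          k * (q * ∣ ρ ∣)  ≡⟨ ℕ.*-assoc k q ∣ ρ ∣ ⟨
          k * q * ∣ ρ ∣    ≤⟨ ℕ.*-monoˡ-≤ ∣ ρ ∣ (m/n*n≤m N q) ⟩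
          N * ∣ ρ ∣        ≡⟨ ℕ.*-comm N ∣ ρ ∣ ⟩
          ∣ ρ ∣ * N        ≤⟨ ℕ.<⇒≤ ρN<m ⟩
          m                ∎))
          (w≥ 0<q 0<∣ρ∣ (ℕ.≤-trans (ℕ.m≤m*n ∣ ρ ∣ N) (ℕ.<⇒≤ ρN<m)) m∣cq-ρ)
        -- The remainder is charged only to x ≤ N′ < q, so the charge k at x = q is new.
        cost≤ : cost N′ + k ≤ cost N
        cost≤ = ≤-via q 0<q N′<q q≤N k≤w
          where
          ≤-via : ∀ q → 0 < q → N′ < q → q ≤ N → k ≤ w q → cost N′ + k ≤ cost N
          ≤-via (suc q) _ (s≤s N′≤q) q<N k≤ = begin
            cost N′ + k        ≤⟨ ℕ.+-mono-≤ (∑-1⋯-mono w N′≤q) k≤ ⟩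
            cost q + w (suc q) ≡⟨ ∑-1⋯-suc q w ⟨
            cost (suc q)       ≤⟨ ∑-1⋯-mono w q<N ⟩
            cost N             ∎

      step : ∀ N → (∀ {N′} → N′ < N → Bounded N′) → Bounded N
      step zero rec N<m H b = ℕ.≤-trans (ℕ.≤-reflexive (ℕ.*-zeroʳ m)) z≤n
      step N@(suc _) rec N<m H b = step′ N (s≤s z≤n) rec N<m H b (dirichlet c m N (s≤s z≤n))
    -- Ostrowski's argument: N steps of x ↦ x + c are cut into N / q blocks of length q,
    -- q the denominator of a good rational approximation to c / m, and a shorter remainder.
    hits-upper : ∀ {N} → N < m → ∀ H b → m * hits m c b N H ≤ N * H + 2 * m * cost N
    hits-upper {N} = <-rec Bounded step N

    -- The upper bound for the complementary interval of length m - H, subtracted from the total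
    -- number N of points.
    hits-lower : ∀ {N} → N < m → ∀ {H} → H ≤ m → ∀ b → N * H ≤ m * hits m c b N H + 2 * m * cost N
    hits-lower {N} N<m {H} H≤m b = ℕ.+-cancelʳ-≤ (N * (m ∸ H)) _ _ (begin
      N * H + N * (m ∸ H)                ≡⟨ ℕ.*-distribˡ-+ N H (m ∸ H) ⟨
      N * (H + (m ∸ H))                  ≡⟨ cong (N *_) (ℕ.m+[n∸m]≡n H≤m) ⟩
      N * m                              ≡⟨ ℕ.*-comm N m ⟩
      m * N                              ≡⟨ cong (m *_) (hits-complement H≤m c b N) ⟨
      m * (hits m c b N H + hits m c (b + (m ∸ H)) N (m ∸ H))  ≡⟨ ℕ.*-distribˡ-+ m _ _ ⟩
      m * hits m c b N H + m * hits m c (b + (m ∸ H)) N (m ∸ H)  ≤⟨ ℕ.+-monoʳ-≤ _ (hits-upper N<m (m ∸ H) (b + (m ∸ H))) ⟩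
      m * hits m c b N H + (N * (m ∸ H) + 2 * m * cost N)  ≡⟨ ring (m * hits m c b N H) (N * (m ∸ H)) (2 * m * cost N) ⟩
      m * hits m c b N H + 2 * m * cost N + N * (m ∸ H)    ∎)
      where
      open ≤-Reasoning
      ring : ∀ a b c → a + (b + c) ≡ a + c + b
      ring = ℕ-solve

  -- Solutions for a fixed pair (v₁ , v₂)

  ∣-combination : ∀ {m x y z} a b → + m ∣ x → + m ∣ y → z ≡ a ℤ.* x ℤ.+ b ℤ.* y → + m ∣ z
  ∣-combination {m} a b m∣x m∣y z≡ = subst (+ m ∣_) (sym z≡) (ℤ.∣m∣n⇒∣m+n (ℤ.∣n⇒∣m*n a m∣x) (ℤ.∣n⇒∣m*n b m∣y))

  coprime-cancel : ∀ {v m x} → Coprime v m → + m ∣ + v ℤ.* x → + m ∣ x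
  coprime-cancel {v} {m} {x} v⊥m m∣vx = ∣ᵤ⇒∣ (coprime-divisor (Coprime.sym v⊥m) (subst (m ℕ.∣_) (ℤ.abs-* (+ v) x) (∣⇒∣ᵤ m∣vx)))

  inverse : ∀ {v m} → Coprime v m → ∃ λ u → + m ∣ + v ℤ.* u ℤ.- + 1
  inverse {v} {m} v⊥m with coprime-Bézout v⊥m
  ... | Bézout.+- x y eq = + x , divides (+ y) (begin
    + v ℤ.* + x ℤ.- + 1               ≡⟨ cong (ℤ._- + 1) (trans (ℤ.*-comm (+ v) (+ x)) (sym (ℤ.pos-* x v))) ⟩
    + (x * v) ℤ.- + 1                 ≡⟨ cong (λ k → + k ℤ.- + 1) eq ⟨
    + (1 + y * m) ℤ.- + 1             ≡⟨ cong (ℤ._- + 1) (trans (ℤ.pos-+ 1 (y * m)) (cong (ℤ._+_ (+ 1)) (ℤ.pos-* y m))) ⟩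
    + 1 ℤ.+ + y ℤ.* + m ℤ.- + 1       ≡⟨ ring (+ y ℤ.* + m) ⟩
    + y ℤ.* + m                       ∎)
    where
    open ≡-Reasoning
    ring : ∀ k → + 1 ℤ.+ k ℤ.- + 1 ≡ k
    ring = ℤ-solve
  ... | Bézout.-+ x y eq = ℤ.- + x , divides (ℤ.- + y) (begin
    + v ℤ.* (ℤ.- + x) ℤ.- + 1         ≡⟨ ring (+ v) (+ x) ⟩
    ℤ.- (+ 1 ℤ.+ + x ℤ.* + v)         ≡⟨ cong ℤ.-_ (cong (ℤ._+_ (+ 1)) (ℤ.pos-* x v)) ⟨
    ℤ.- + (1 + x * v)                 ≡⟨ cong (λ k → ℤ.- + k) eq ⟩
    ℤ.- + (y * m)                     ≡⟨ cong ℤ.-_ (ℤ.pos-* y m) ⟩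
    ℤ.- (+ y ℤ.* + m)                 ≡⟨ ℤ.neg-distribˡ-* (+ y) (+ m) ⟩
    ℤ.- + y ℤ.* + m                   ∎)
    where
    open ≡-Reasoning
    ring : ∀ v x → v ℤ.* (ℤ.- x) ℤ.- + 1 ≡ ℤ.- (+ 1 ℤ.+ x ℤ.* v)
    ring = ℤ-solve

  residue : ∀ m z .{{_ : NonZero m}} → ∃ λ c → + m ∣ + c ℤ.- z
  residue m z = z %ℕ m , divides (ℤ.- (z /ℕ m)) (trans (cong (ℤ._-_ (+ (z %ℕ m))) (a≡a%ℕn+[a/ℕn]*n z m)) (ring (+ (z %ℕ m)) (z /ℕ m) (+ m)))
    where
    ring : ∀ r k m → r ℤ.- (r ℤ.+ k ℤ.* m) ≡ (ℤ.- k) ℤ.* m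
    ring = ℤ-solve

  -- Multiply z by an inverse of v and reduce: `hits` takes a natural multiplier and offset, whereas
  -- z may be negative.
  solve-congruence : ∀ {v m} .{{_ : NonZero m}} → Coprime v m → ∀ z → ∃ λ c → + m ∣ + v ℤ.* + c ℤ.- z
  solve-congruence {v} {m} v⊥m z with u , m∣vu-1 ← inverse v⊥m with c , m∣c-uz ← residue m (u ℤ.* z) =
    c , ∣-combination (+ v) z m∣c-uz m∣vu-1 (ring (+ v) (+ c) u z)
    where
    ring : ∀ v c u z → v ℤ.* c ℤ.- z ≡ v ℤ.* (c ℤ.- u ℤ.* z) ℤ.+ z ℤ.* (v ℤ.* u ℤ.- + 1)
    ring = ℤ-solve

  signs : List (ℕ → ℤ)
  signs = +_ ∷ (λ r → ℤ.- + r) ∷ []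

  signed-abs : ∀ ρ → ∃ λ ± → ± ∈ signs × ± ∣ ρ ∣ ≡ ρ
  signed-abs (+ _)      = _ , here refl , refl
  signed-abs ℤ.-[1+ _ ] = _ , there (here refl) , refl

  -- The weight used in the recursion. The condition c x ≡ ρ is multiplied by v₂ to read v₁ x ≡ v₂
  -- ρ, so that c disappears and x, ρ can later be fixed while (v₁ , v₂) varies. ρ is split into a
  -- sign and a size r.
  step-cost : ℕ → ℕ → ℕ → ℕ → ℕ
  step-cost m v₁ v₂ x = ∑[ r ∈ ⟦1⋯ m ⟧ ] ∑[ ± ∈ signs ] 𝟙 (+ m ∣? + v₁ ℤ.* + x ℤ.- + v₂ ℤ.* ± r) * (m ÷ (x * r))

  total-cost : ℕ → ℕ → ℕ → ℕ
  total-cost m v₁ v₂ = ∑ ⟦1⋯ m ⟧ (step-cost m v₁ v₂)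

  ≤-step-cost : ∀ {m v₁ v₂ x ρ} → 0 < ∣ ρ ∣ → ∣ ρ ∣ ≤ m → + m ∣ + v₁ ℤ.* + x ℤ.- + v₂ ℤ.* ρ →
    m ÷ (x * ∣ ρ ∣) ≤ step-cost m v₁ v₂ x
  ≤-step-cost {m} {v₁} {v₂} {x} {ρ} 0<ρ ρ≤m m∣ with ± , ±∈ , ±≡ρ ← signed-abs ρ = begin
    m ÷ (x * r)                     ≡⟨ ℕ.*-identityˡ _ ⟨
    1 * (m ÷ (x * r))               ≡⟨ cong (_* (m ÷ (x * r))) (𝟙-yes (+ m ∣? _) (subst (λ z → + m ∣ + v₁ ℤ.* + x ℤ.- + v₂ ℤ.* z) (sym ±≡ρ) m∣)) ⟨
    f ± r                           ≤⟨ ≤-∑ (λ ± → f ± r) ±∈ ⟩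
    ∑[ ± ∈ signs ] f ± r            ≤⟨ ≤-∑ (λ r → ∑[ ± ∈ signs ] f ± r) (∈-1⋯⁺ 0<ρ ρ≤m) ⟩
    step-cost m v₁ v₂ x              ∎
    where
    open ≤-Reasoning
    r = ∣ ρ ∣
    f : (ℕ → ℤ) → ℕ → ℕ
    f ± r = 𝟙 (+ m ∣? + v₁ ℤ.* + x ℤ.- + v₂ ℤ.* ± r) * (m ÷ (x * r))

  pair-solutions : ℕ → ℕ → ℕ → ℤ → ℕ → ℕ
  pair-solutions m v₁ v₂ S L = ∑[ y₁ ∈ interval S L ] ∑[ y₂ ∈ interval S L ] 𝟙 (solvesCongruence? m (v₁ , v₂ , y₁ , y₂))

  J-pairs : ∀ m V S L → J m V S L ≡ ∑[ v₁ ∈ V ] ∑[ v₂ ∈ V ] pair-solutions m v₁ v₂ S L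
  J-pairs m V S L = begin
    J m V S L ≡⟨ length-filter (solvesCongruence? m) (cartesianProduct V (cartesianProduct V (cartesianProduct I I))) ⟩
    ∑[ q ∈ cartesianProduct V (cartesianProduct V (cartesianProduct I I)) ] χ q ≡⟨ ∑-cartesianProduct V _ χ ⟩
    ∑[ v₁ ∈ V ] ∑[ q ∈ cartesianProduct V (cartesianProduct I I) ] χ (v₁ , q)
      ≡⟨ ∑-cong V (λ {v₁} _ → trans (∑-cartesianProduct V _ (λ q → χ (v₁ , q)))
           (∑-cong V λ {v₂} _ → ∑-cartesianProduct I I (λ q → χ (v₁ , v₂ , q)))) ⟩
    ∑[ v₁ ∈ V ] ∑[ v₂ ∈ V ] pair-solutions m v₁ v₂ S L ∎
    where
    open ≡-Reasoning
    I = interval S L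
    χ : Quadruple → ℕ
    χ q = 𝟙 (solvesCongruence? m q)

  -- With y₁ = S + 1 + i and y₂ = S + 1 + j, the congruence becomes j ≡ c i + b, the offset b
  -- absorbing S. Since j < L ≤ m, each i has at most one partner j, namely the residue of c i + b
  -- when that is below L.
  pair-solutions-hits : ∀ {m v₁ v₂ c b S L} .{{_ : NonZero m}} → Coprime v₂ m → L ≤ m →
    + m ∣ + v₂ ℤ.* + c ℤ.- + v₁ → + m ∣ + v₂ ℤ.* + b ℤ.- (+ v₁ ℤ.- + v₂) ℤ.* (S ℤ.+ + 1) →
    pair-solutions m v₁ v₂ S L ≡ hits m c b L L
  pair-solutions-hits {m} {v₁} {v₂} {c} {b} {S} {L} v₂⊥m L≤m m∣c m∣b = begin
    pair-solutions m v₁ v₂ S L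
      ≡⟨ ∑-applyUpTo _ L _ ⟩
    ∑[ i ∈ upTo L ] ∑[ y₂ ∈ interval S L ] 𝟙 (solvesCongruence? m (v₁ , v₂ , S ℤ.+ + suc i , y₂))
      ≡⟨ ∑-cong (upTo L) (λ {i} _ → trans (∑-applyUpTo _ L _) (trans
           (∑-cong (upTo L) λ {j} j∈ → 𝟙-cong (+ m ∣? _) (_ ℕ.≟ j) (to i (ℕ.<-≤-trans (∈-upTo⁻ j∈) L≤m)) (from i j))
           (∑-𝟙-≡ ((c * i + b) % m) L))) ⟩
    hits m c b L L ∎
    where
    open ≡-Reasoning
    y-def : ∀ i → + ((c * i + b) % m) ≡ + c ℤ.* + i ℤ.+ + b ℤ.- + ((c * i + b) / m) ℤ.* + m
    y-def i = trans (ring (+ ((c * i + b) % m)) (+ ((c * i + b) / m) ℤ.* + m))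
      (cong (ℤ._- + ((c * i + b) / m) ℤ.* + m) (trans (sym (divMod-ℤ (c * i + b) m)) (pos-*-+ c i b)))
      where
      ring : ∀ y k → y ≡ k ℤ.+ y ℤ.- k
      ring = ℤ-solve

    m∣diff : ∀ i j → + m ∣ (+ v₁ ℤ.* (S ℤ.+ + suc i) ℤ.- + v₂ ℤ.* (S ℤ.+ + suc j)) ℤ.- + v₂ ℤ.* (+ ((c * i + b) % m) ℤ.- + j)
    m∣diff i j = ∣-combination (+ 1) (+ v₂ ℤ.* + ((c * i + b) / m)) (∣-combination (ℤ.- + i) (ℤ.- + 1) m∣c m∣b refl) ℤ.∣-refl
      (trans (cong (λ y → (+ v₁ ℤ.* (S ℤ.+ + suc i) ℤ.- + v₂ ℤ.* (S ℤ.+ + suc j)) ℤ.- + v₂ ℤ.* (y ℤ.- + j)) (y-def i))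
        (ring (+ v₁) (+ v₂) S (+ i) (+ j) (+ c) (+ b) (+ ((c * i + b) / m)) (+ m)))
      where
      ring : ∀ v₁ v₂ S i j c b k m →
        (v₁ ℤ.* (S ℤ.+ (+ 1 ℤ.+ i)) ℤ.- v₂ ℤ.* (S ℤ.+ (+ 1 ℤ.+ j))) ℤ.- v₂ ℤ.* ((c ℤ.* i ℤ.+ b ℤ.- k ℤ.* m) ℤ.- j)
        ≡ + 1 ℤ.* ((ℤ.- i) ℤ.* (v₂ ℤ.* c ℤ.- v₁) ℤ.+ (ℤ.- + 1) ℤ.* (v₂ ℤ.* b ℤ.- (v₁ ℤ.- v₂) ℤ.* (S ℤ.+ + 1))) ℤ.+ (v₂ ℤ.* k) ℤ.* m
      ring = ℤ-solve

    to : ∀ i {j} → j < m → SolvesCongruence m (v₁ , v₂ , S ℤ.+ + suc i , S ℤ.+ + suc j) → (c * i + b) % m ≡ j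
    to i {j} j<m sol = residue-unique (m%n<n (c * i + b) m) j<m (coprime-cancel v₂⊥m
      (∣-combination (+ 1) (ℤ.- + 1) sol (m∣diff i j) (ring (+ v₁ ℤ.* (S ℤ.+ + suc i) ℤ.- + v₂ ℤ.* (S ℤ.+ + suc j)) (+ v₂ ℤ.* (+ ((c * i + b) % m) ℤ.- + j)))))
      where
      ring : ∀ e x → x ≡ + 1 ℤ.* e ℤ.+ (ℤ.- + 1) ℤ.* (e ℤ.- x)
      ring = ℤ-solve

    from : ∀ i j → (c * i + b) % m ≡ j → SolvesCongruence m (v₁ , v₂ , S ℤ.+ + suc i , S ℤ.+ + suc j)
    from i _ refl = ∣-combination (+ 1) (+ v₂) (m∣diff i j) (divides 0ℤ (ℤ.i≡j⇒i-j≡0 {+ j} refl)) (ring (+ v₁ ℤ.* (S ℤ.+ + suc i) ℤ.- + v₂ ℤ.* (S ℤ.+ + suc j)) (+ v₂) (+ j ℤ.- + j))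
      where
      j = (c * i + b) % m
      ring : ∀ e v x → e ≡ + 1 ℤ.* (e ℤ.- v ℤ.* x) ℤ.+ v ℤ.* x
      ring = ℤ-solve

  hits-full : ∀ m c b N .{{_ : NonZero m}} → hits m c b N m ≡ N
  hits-full m c b N = trans (∑-cong (upTo N) λ {i} _ → 𝟙-yes (_ ℕ.<? m) (m%n<n (c * i + b) m))
    (trans (∑-const (upTo N) 1) (trans (ℕ.*-identityʳ _) (length-upTo N)))

  Estimate : (X Y ε : ℕ) → Set
  Estimate X Y ε = X ≤ Y + ε × Y ≤ X + ε

  hits-estimate : ∀ {m v₁ v₂ c L} .{{_ : NonZero m}} → Coprime v₁ m → L ≤ m →
    + m ∣ + v₂ ℤ.* + c ℤ.- + v₁ → ∀ b → Estimate (m * hits m c b L L) (L * L) (2 * m * total-cost m v₁ v₂)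
  hits-estimate {m} {v₁} {v₂} {c} {L} v₁⊥m L≤m m∣c b with ℕ.m≤n⇒m<n∨m≡n L≤m
  -- The recursion needs a length below m, to exclude ρ = 0. For L = m every residue is a hit and
  -- the count is exact.
  ... | inj₂ refl = subst (λ n → Estimate (m * n) (m * m) (2 * m * total-cost m v₁ v₂)) (sym (hits-full m c b m))
    (ℕ.m≤m+n _ _ , ℕ.m≤m+n _ _)
  ... | inj₁ L<m =
    ℕ.≤-trans (hits-upper {c = c} c-unit w (λ {q} {ρ} → w≥ {q} {ρ}) L<m L b) (ℕ.+-monoʳ-≤ (L * L) cost≤) ,
    ℕ.≤-trans (hits-lower {c = c} c-unit w (λ {q} {ρ} → w≥ {q} {ρ}) L<m L≤m b) (ℕ.+-monoʳ-≤ (m * hits m c b L L) cost≤)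
    where
    w = step-cost m v₁ v₂
    cost≤ : 2 * m * ∑ ⟦1⋯ L ⟧ w ≤ 2 * m * total-cost m v₁ v₂
    cost≤ = ℕ.*-monoʳ-≤ (2 * m) (∑-1⋯-mono w L≤m)
    c-unit : ∀ {x} → + m ∣ + c ℤ.* + x → m ℕ.∣ x
    c-unit {x} m∣cx = ∣⇒∣ᵤ (coprime-cancel {x = + x} v₁⊥m (∣-combination (+ v₂) (ℤ.- + x) m∣cx m∣c (ring (+ v₁) (+ v₂) (+ c) (+ x))))
      where
      ring : ∀ v₁ v₂ c x → v₁ ℤ.* x ≡ v₂ ℤ.* (c ℤ.* x) ℤ.+ (ℤ.- x) ℤ.* (v₂ ℤ.* c ℤ.- v₁)
      ring = ℤ-solve
    w≥ : ∀ {q ρ} → 0 < q → 0 < ∣ ρ ∣ → ∣ ρ ∣ ≤ m → + m ∣ + c ℤ.* + q ℤ.- ρ → m ÷ (q * ∣ ρ ∣) ≤ w q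
    w≥ {q} {ρ} _ 0<ρ ρ≤m m∣ = ≤-step-cost {v₁ = v₁} {v₂} {q} {ρ} 0<ρ ρ≤m
      (∣-combination (+ v₂) (ℤ.- + q) m∣ m∣c (ring (+ v₁) (+ v₂) (+ c) (+ q) ρ))
      where
      ring : ∀ v₁ v₂ c q r → v₁ ℤ.* q ℤ.- v₂ ℤ.* r ≡ v₂ ℤ.* (c ℤ.* q ℤ.- r) ℤ.+ (ℤ.- q) ℤ.* (v₂ ℤ.* c ℤ.- v₁)
      ring = ℤ-solve

  pair-estimate : ∀ {m v₁ v₂ S L} .{{_ : NonZero m}} → Coprime v₁ m → Coprime v₂ m → L ≤ m →
    Estimate (m * pair-solutions m v₁ v₂ S L) (L * L) (2 * m * total-cost m v₁ v₂)
  pair-estimate {m} {v₁} {v₂} {S} {L} v₁⊥m v₂⊥m L≤m =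
    let c , m∣c = solve-congruence v₂⊥m (+ v₁)
        b , m∣b = solve-congruence v₂⊥m ((+ v₁ ℤ.- + v₂) ℤ.* (S ℤ.+ + 1))
    in subst (λ n → Estimate (m * n) (L * L) (2 * m * total-cost m v₁ v₂))
         (sym (pair-solutions-hits {S = S} v₂⊥m L≤m m∣c m∣b)) (hits-estimate {v₂ = v₂} {c = c} v₁⊥m L≤m m∣c b)

  diagonal-solutions : ∀ {m v S L} .{{_ : NonZero m}} → Coprime v m → L ≤ m → pair-solutions m v v S L ≡ L
  diagonal-solutions {m} {v} {S} {L} v⊥m L≤m = begin
    pair-solutions m v v S L          ≡⟨ pair-solutions-hits {c = 1} {b = 0} {S} v⊥m L≤m (divides 0ℤ (ring₁ (+ v))) (divides 0ℤ (ring₂ (+ v) S)) ⟩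
    hits m 1 0 L L                    ≡⟨ ∑-cong (upTo L) (λ {i} i∈ → 𝟙-yes (_ ℕ.<? L) (subst (_< L) (sym (residue≡ i (∈-upTo⁻ i∈))) (∈-upTo⁻ i∈))) ⟩
    ∑[ i ∈ upTo L ] 1                 ≡⟨ ∑-const (upTo L) 1 ⟩
    length (upTo L) * 1               ≡⟨ trans (ℕ.*-identityʳ _) (length-upTo L) ⟩
    L                                 ∎
    where
    open ≡-Reasoning
    ring₁ : ∀ v → v ℤ.* + 1 ℤ.- v ≡ 0ℤ
    ring₁ = ℤ-solve
    ring₂ : ∀ v S → v ℤ.* 0ℤ ℤ.- (v ℤ.- v) ℤ.* (S ℤ.+ + 1) ≡ 0ℤ
    ring₂ = ℤ-solve
    residue≡ : ∀ i → i < L → (1 * i + 0) % m ≡ i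
    residue≡ i i<L = trans (cong (_% m) (trans (ℕ.+-identityʳ _) (ℕ.*-identityˡ i))) (m<n⇒m%n≡m (ℕ.<-≤-trans i<L L≤m))

  -- Summation over all pairs

  off-diagonal-cost : ℕ → List ℕ → ℕ
  off-diagonal-cost m V = ∑[ v₁ ∈ V ] ∑[ v₂ ∈ V ] 𝟙 (¬? (v₁ ℕ.≟ v₂)) * total-cost m v₁ v₂

  -- Off the diagonal m times the count is compared with L²; on it the count is exactly L. Adding L²
  -- to one side and m L to the other for each diagonal pair puts both cases in one form and avoids
  -- subtraction.
  J-estimate : ∀ {m V S L} .{{_ : NonZero m}} → Unique V → All (λ v → Coprime v m) V → L ≤ m →
    let #V = length V in
    Estimate (m * J m V S L + #V * (L * L)) (#V * #V * (L * L) + #V * (m * L)) (2 * m * off-diagonal-cost m V)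
  J-estimate {m} {V} {S} {L} V-unique V⊥m L≤m =
    subst₂ _≤_ (sym lhs) (cong (_+ 2 * m * ∑∑ cost) (sym rhs)) (pairwise λ v₁∈ v₂∈ → proj₁ (both v₁∈ v₂∈)) ,
    subst₂ _≤_ (sym rhs) (cong (_+ 2 * m * ∑∑ cost) (sym lhs)) (pairwise λ v₁∈ v₂∈ → proj₂ (both v₁∈ v₂∈))
    where
    #V = length V

    ∑∑ : (ℕ → ℕ → ℕ) → ℕ
    ∑∑ f = ∑[ v₁ ∈ V ] ∑[ v₂ ∈ V ] f v₁ v₂

    ∑∑-+ : ∀ f g → ∑∑ (λ v₁ v₂ → f v₁ v₂ + g v₁ v₂) ≡ ∑∑ f + ∑∑ g
    ∑∑-+ f g = trans (∑-cong V λ {v₁} _ → ∑-+ V (f v₁) (g v₁)) (∑-+ V (λ v₁ → ∑ V (f v₁)) (λ v₁ → ∑ V (g v₁)))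

    ∑∑-*ˡ : ∀ c f → ∑∑ (λ v₁ v₂ → c * f v₁ v₂) ≡ c * ∑∑ f
    ∑∑-*ˡ c f = trans (∑-cong V λ {v₁} _ → ∑-*ˡ V c (f v₁)) (∑-*ˡ V c _)

    δ : ℕ → ℕ → ℕ
    δ v₁ v₂ = 𝟙 (v₁ ℕ.≟ v₂)

    ∑∑-δ : ∀ c → ∑∑ (λ v₁ v₂ → δ v₁ v₂ * c) ≡ #V * c
    ∑∑-δ c = trans (∑-cong V λ {v₁} v₁∈ → trans (∑-*ʳ V c (δ v₁)) (trans (cong (_* c) (row v₁∈)) (ℕ.*-identityˡ c))) (∑-const V c)
      where
      row : ∀ {v₁} → v₁ ∈ V → ∑ V (δ v₁) ≡ 1
      row {v₁} v₁∈ = ℕ.≤-antisym (∑-𝟙-≤1 (v₁ ℕ.≟_) V-unique λ _ _ p q → trans (sym p) q)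
        (ℕ.≤-trans (ℕ.≤-reflexive (sym (𝟙-yes (v₁ ℕ.≟ v₁) refl))) (≤-∑ (δ v₁) v₁∈))

    N cost : ℕ → ℕ → ℕ
    N v₁ v₂ = pair-solutions m v₁ v₂ S L
    cost v₁ v₂ = 𝟙 (¬? (v₁ ℕ.≟ v₂)) * total-cost m v₁ v₂

    left right : ℕ → ℕ → ℕ
    left  v₁ v₂ = m * N v₁ v₂ + δ v₁ v₂ * (L * L)
    right v₁ v₂ = L * L + δ v₁ v₂ * (m * L)

    lhs : m * J m V S L + #V * (L * L) ≡ ∑∑ left
    lhs = sym (trans (∑∑-+ _ _) (cong₂ _+_ (trans (∑∑-*ˡ m N) (cong (m *_) (sym (J-pairs m V S L)))) (∑∑-δ (L * L))))

    rhs : #V * #V * (L * L) + #V * (m * L) ≡ ∑∑ right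
    rhs = sym (trans (∑∑-+ _ _) (cong₂ _+_ (trans (∑-cong V λ _ → ∑-const V (L * L)) (trans (∑-const V _) (sym (ℕ.*-assoc #V #V _)))) (∑∑-δ (m * L))))

    both : ∀ {v₁ v₂} → v₁ ∈ V → v₂ ∈ V → Estimate (left v₁ v₂) (right v₁ v₂) (2 * m * cost v₁ v₂)
    both {v₁} {v₂} v₁∈ v₂∈ = combine (v₁ ℕ.≟ v₂)
        (λ { refl → diagonal-solutions {S = S} (All.lookup V⊥m v₁∈) L≤m })
        (pair-estimate {S = S} (All.lookup V⊥m v₁∈) (All.lookup V⊥m v₂∈) L≤m)
      where
      combine : ∀ {n} {e} {P : Set} (P? : Dec P) → (P → n ≡ L) → Estimate (m * n) (L * L) (2 * m * e) →
        Estimate (m * n + 𝟙 P? * (L * L)) (L * L + 𝟙 P? * (m * L)) (2 * m * (𝟙 (¬? P?) * e))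
      combine (yes p) n≡L _ rewrite n≡L p =
        ℕ.≤-trans (ℕ.≤-reflexive (swap (m * L) (L * L))) (ℕ.m≤m+n _ _) ,
        ℕ.≤-trans (ℕ.≤-reflexive (sym (swap (m * L) (L * L)))) (ℕ.m≤m+n _ _)
        where
        swap : ∀ a b → a + (b + 0) ≡ b + (a + 0)
        swap = ℕ-solve
      combine {n} {e} (no _) _ (upper , lower) = pad upper , pad lower
        where
        ring : ∀ a b c → a + b * c ≡ a + 0 + b * (c + 0)
        ring = ℕ-solve
        pad : ∀ {a b} → a ≤ b + 2 * m * e → a + 0 ≤ b + 0 + 2 * m * (e + 0)
        pad {a} {b} le = subst₂ _≤_ (sym (ℕ.+-identityʳ a)) (ring b (2 * m) e) le

    pairwise : ∀ {f g} → (∀ {v₁ v₂} → v₁ ∈ V → v₂ ∈ V → f v₁ v₂ ≤ g v₁ v₂ + 2 * m * cost v₁ v₂) →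
      ∑∑ f ≤ ∑∑ g + 2 * m * ∑∑ cost
    pairwise {f} {g} le = ℕ.≤-trans (∑-mono V λ v₁∈ → ∑-mono V λ v₂∈ → le v₁∈ v₂∈)
      (ℕ.≤-reflexive (trans (∑∑-+ g _) (cong (_+_ (∑∑ g)) (∑∑-*ˡ (2 * m) cost))))

  -- Totients and divisors

  φ-∑ : ∀ n → φ n ≡ ∑[ a ∈ ⟦1⋯ n ⟧ ] 𝟙 (coprime? a n)
  φ-∑ n = length-filter (λ a → coprime? a n) ⟦1⋯ n ⟧

  -- Coprimality to d e implies coprimality to e, which is periodic with period e, and 1, ..., d e
  -- consists of d periods.
  φ-*-≤ : ∀ d e → φ (d * e) ≤ d * φ e
  φ-*-≤ d e = begin
    φ (d * e)                                          ≡⟨ φ-∑ (d * e) ⟩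
    ∑[ a ∈ ⟦1⋯ d * e ⟧ ] 𝟙 (coprime? a (d * e))        ≤⟨ ∑-mono ⟦1⋯ d * e ⟧ (λ {a} _ → 𝟙-≤ (coprime? a (d * e)) (coprime? a e)
                                                            λ a⊥de (k∣a , k∣e) → a⊥de (k∣a , ℕ.∣-trans k∣e (ℕ.n∣m*n d))) ⟩
    ∑[ a ∈ ⟦1⋯ d * e ⟧ ] χ a                           ≡⟨ periodic d ⟩
    d * (∑[ a ∈ ⟦1⋯ e ⟧ ] χ a)                         ≡⟨ cong (d *_) (φ-∑ e) ⟨
    d * φ e                                            ∎
    where
    open ≤-Reasoning
    χ : ℕ → ℕ
    χ a = 𝟙 (coprime? a e)
    shift : ∀ i → χ (suc (e + i)) ≡ χ (suc i)
    shift i = 𝟙-cong (coprime? (suc (e + i)) e) (coprime? (suc i) e)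
      (λ c {k} (k∣i , k∣e) → c (subst (k ℕ.∣_) (ℕ.+-suc e i) (ℕ.∣m∣n⇒∣m+n k∣e k∣i) , k∣e))
      (λ c → subst (λ n → Coprime n e) (ℕ.+-suc e i) (coprime-+ c))
    periodic : ∀ d → ∑ ⟦1⋯ d * e ⟧ χ ≡ d * ∑ ⟦1⋯ e ⟧ χ
    periodic zero    = refl
    periodic (suc d) = trans (∑-applyUpTo-+ suc e (d * e) χ) (cong (_+_ (∑ ⟦1⋯ e ⟧ χ))
      (trans (trans (∑-applyUpTo _ (d * e) χ) (trans (∑-cong (upTo (d * e)) λ {i} _ → shift i) (sym (∑-applyUpTo suc (d * e) χ)))) (periodic d)))

  -- Divisors d of m, each carrying its codivisor e: φ is evaluated at e, and e is the modulus left
  -- after cancelling d.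
  factorizations : ℕ → List (ℕ × ℕ)
  factorizations m = filter (λ (d , e) → d * e ℕ.≟ m) (cartesianProduct ⟦1⋯ m ⟧ ⟦1⋯ m ⟧)

  ∈-factorizations⁺ : ∀ {m d e} → 0 < m → d * e ≡ m → (d , e) ∈ factorizations m
  ∈-factorizations⁺ {m} {d} {e} 0<m refl = ∈-filter⁺ (λ (d , e) → d * e ℕ.≟ m)
    (∈-cartesianProduct⁺ (∈-1⋯⁺ (ℕ.>-nonZero⁻¹ d) (ℕ.m≤m*n d e)) (∈-1⋯⁺ (ℕ.>-nonZero⁻¹ e) (ℕ.m≤n*m e d))) refl
    where
    instance
      m≢0 = ℕ.>-nonZero 0<m
      d≢0 = ℕ.m*n≢0⇒m≢0 d
      e≢0 = ℕ.m*n≢0⇒n≢0 d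

  ∈-factorizations⁻ : ∀ {m d e} → (d , e) ∈ factorizations m → 1 ≤ d × 1 ≤ e × d * e ≡ m
  ∈-factorizations⁻ {m} ∈F with ∈R , de≡m ← ∈-filter⁻ (λ (d , e) → d * e ℕ.≟ m) {xs = cartesianProduct ⟦1⋯ m ⟧ ⟦1⋯ m ⟧} ∈F
    with d∈ , e∈ ← ∈-cartesianProduct⁻ ⟦1⋯ m ⟧ ⟦1⋯ m ⟧ ∈R = proj₁ (∈-1⋯⁻ d∈) , proj₁ (∈-1⋯⁻ e∈) , de≡m

  factorizations-unique : ∀ m → Unique (factorizations m)
  factorizations-unique m = Unique.filter⁺ (λ (d , e) → d * e ℕ.≟ m) (Unique.cartesianProduct⁺ (1⋯-unique m) (1⋯-unique m))

  -- Gauss's argument: the x ≤ m are sorted by gcd (x , m), and a ↦ d a sends the a ≤ e coprime to e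
  -- injectively into the class of d.
  ∑-φ : ∀ m → ∑[ (d , e) ∈ factorizations m ] φ e ≤ m
  ∑-φ m = begin
    ∑[ (d , e) ∈ F ] φ e                                       ≤⟨ ∑-mono F class ⟩
    ∑[ (d , e) ∈ F ] ∑[ x ∈ ⟦1⋯ m ⟧ ] 𝟙 (gcd x m ℕ.≟ d)        ≡⟨ ∑-swap F ⟦1⋯ m ⟧ _ ⟩
    ∑[ x ∈ ⟦1⋯ m ⟧ ] ∑[ (d , e) ∈ F ] 𝟙 (gcd x m ℕ.≟ d)        ≤⟨ ∑-mono ⟦1⋯ m ⟧ (λ {x} _ → ∑-𝟙-≤1 (λ (d , e) → gcd x m ℕ.≟ d) (factorizations-unique m) (only {x})) ⟩
    ∑[ x ∈ ⟦1⋯ m ⟧ ] 1                                         ≡⟨ trans (∑-const ⟦1⋯ m ⟧ 1) (ℕ.*-identityʳ _) ⟩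
    length ⟦1⋯ m ⟧                                             ≡⟨ length-applyUpTo suc m ⟩
    m                                                          ∎
    where
    open ≤-Reasoning
    F = factorizations m
    class : ∀ {de} → de ∈ F → φ (proj₂ de) ≤ ∑[ x ∈ ⟦1⋯ m ⟧ ] 𝟙 (gcd x m ℕ.≟ proj₁ de)
    class {d , e} ∈F with 1≤d , 1≤e , refl ← ∈-factorizations⁻ {m} ∈F = subst (φ e ≤_) (length-filter (λ x → gcd x m ℕ.≟ d) ⟦1⋯ m ⟧)
      (length-≤ (d *_) (Unique.filter⁺ (λ a → coprime? a e) (1⋯-unique e)) into
        λ _ _ → ℕ.*-cancelˡ-≡ _ _ d)
      where
      instance d≢0 = ℕ.>-nonZero 1≤d
      into : ∀ {a} → a ∈ filter (λ a → coprime? a e) ⟦1⋯ e ⟧ → d * a ∈ filter (λ x → gcd x m ℕ.≟ d) ⟦1⋯ m ⟧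
      into {a} a∈ with a∈R , a⊥e ← ∈-filter⁻ (λ a → coprime? a e) {xs = ⟦1⋯ e ⟧} a∈ with 1≤a , a≤e ← ∈-1⋯⁻ a∈R =
        ∈-filter⁺ (λ x → gcd x m ℕ.≟ d) (∈-1⋯⁺ (ℕ.*-mono-≤ 1≤d 1≤a) (ℕ.*-monoʳ-≤ d a≤e))
          (trans (sym (c*gcd[m,n]≡gcd[cm,cn] d a e)) (trans (cong (d *_) (coprime⇒gcd≡1 a⊥e)) (ℕ.*-identityʳ d)))
    only : ∀ {x} {p q : ℕ × ℕ} → p ∈ F → q ∈ F → gcd x m ≡ proj₁ p → gcd x m ≡ proj₁ q → p ≡ q
    only {x} {d , e} {_ , e′} p∈ q∈ refl refl with 1≤d , _ , de≡m ← ∈-factorizations⁻ {m} p∈ | _ , _ , de′≡m ← ∈-factorizations⁻ {m} q∈ =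
      cong (d ,_) (ℕ.*-cancelˡ-≡ e e′ d {{ℕ.>-nonZero 1≤d}} (trans de≡m (sym de′≡m)))

  -- Pairs of primes belonging to a fixed (x , y)

  maximum : ∀ {A : Set} (f : A → ℕ) x xs → ∃ λ w → w ∈ (x ∷ xs) × (∀ {z} → z ∈ (x ∷ xs) → f z ≤ f w)
  maximum f x [] = x , here refl , λ { (here refl) → ℕ.≤-refl }
  maximum f x (y ∷ ys) with maximum f y ys
  ... | w , w∈ , max with ℕ.≤-total (f x) (f w)
  ...   | inj₁ x≤w = w , there w∈ , λ { (here refl) → x≤w ; (there z∈) → max z∈ }
  ...   | inj₂ w≤x = x , here refl , λ { (here refl) → ℕ.≤-refl ; (there z∈) → ℕ.≤-trans (max z∈) w≤x }

  distinct-primes-coprime : ∀ {p q} → Prime p → Prime q → p ≢ q → Coprime p q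
  distinct-primes-coprime {p} {q} pp pq p≢q with ℕ.<-cmp p q
  ... | tri< p<q _ _ = Coprime.sym (prime⇒coprime pq {{prime⇒nonZero pp}} p<q)
  ... | tri≈ _ p≡q _ = contradiction p≡q p≢q
  ... | tri> _ _ q<p = prime⇒coprime pp {{prime⇒nonZero pq}} q<p

  *-≤-of-squares : ∀ a b {m} → a ℕ.^ 2 ≤ m → b ℕ.^ 2 ≤ m → a * b ≤ m
  *-≤-of-squares a b {m} a²≤m b²≤m with ℕ.≤-total a b
  ... | inj₁ a≤b = ℕ.≤-trans (ℕ.*-mono-≤ a≤b (ℕ.≤-reflexive (sym (ℕ.*-identityʳ b)))) b²≤m
  ... | inj₂ b≤a = ℕ.≤-trans (ℕ.*-monoʳ-≤ a (subst (b ≤_) (sym (ℕ.*-identityʳ a)) b≤a)) a²≤m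

  -- Representatives run from 1 to m here because this is applied with modulus w₁ to first
  -- coordinates that may equal w₁.
  residue-unique⁺ : ∀ {m x y} → 1 ≤ x → x ≤ m → 1 ≤ y → y ≤ m → + m ∣ + x ℤ.- + y → x ≡ y
  residue-unique⁺ {m} {suc x} {suc y} _ x<m _ y<m m∣ = cong suc (residue-unique x<m y<m (subst (+ m ∣_) (ring (+ x) (+ y)) m∣))
    where
    ring : ∀ x y → (+ 1 ℤ.+ x) ℤ.- (+ 1 ℤ.+ y) ≡ x ℤ.- y
    ring = ℤ-solve

  Admissible : ℕ → ℕ → Set
  Admissible m v = Prime v × Coprime v m × v ℕ.^ 2 ≤ m

  module _ {m : ℕ} .{{_ : NonZero m}} {x : ℕ} {y : ℤ} (1≤x : 1 ≤ x) (x≤m : x ≤ m) (0<y : 0 < ∣ y ∣) (y≤m : ∣ y ∣ ≤ m)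
    {Z : List (ℕ × ℕ)} (Z-unique : Unique Z)
    (Z-sound : ∀ {v₁ v₂} → (v₁ , v₂) ∈ Z → Admissible m v₁ × Admissible m v₂ × v₁ ≢ v₂ × + m ∣ + v₁ ℤ.* + x ℤ.- + v₂ ℤ.* y)
    where

    private
      1≤prime : ∀ {v} → Prime v → 1 ≤ v
      1≤prime p = ℕ.>-nonZero⁻¹ _ {{prime⇒nonZero p}}

    -- A solution v is labelled by the determinant of v and w (shifted by m to make it
    -- natural), where w is a solution with largest first coordinate. The determinant is a
    -- multiple of e below m in absolute value, and it determines v because w₁ and w₂ are
    -- coprime and 1 ≤ v₁ ≤ w₁.
    proportional-pairs-≤ : ∀ {w₁ w₂ d e j} → (w₁ , w₂) ∈ Z → (∀ {z} → z ∈ Z → proj₁ z ≤ w₁) →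
      d * e ≡ m → d * j ≡ x → Coprime e j → length Z ≤ 2 * d
    proportional-pairs-≤ {w₁} {w₂} {d} {e} {j} w∈ w-max de≡m dj≡x e⊥j = subst (length Z ≤_) (length-upTo (2 * d))
      (length-≤ {ys = upTo (2 * d)} (λ z → det z / e) Z-unique into inj)
      where
      instance
        de≢0 : NonZero (d * e)
        de≢0 = ℕ.>-nonZero (subst (0 <_) (sym de≡m) (ℕ.>-nonZero⁻¹ m))
        d≢0 : NonZero d
        d≢0 = ℕ.m*n≢0⇒m≢0 d
        e≢0 : NonZero e
        e≢0 = ℕ.m*n≢0⇒n≢0 d

      w-sound = Z-sound w∈
      aw₁ = proj₁ w-sound
      aw₂ = proj₁ (proj₂ w-sound)
      m∣w = proj₂ (proj₂ (proj₂ w-sound))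
      instance
        w₁≢0 : NonZero w₁
        w₁≢0 = prime⇒nonZero (proj₁ aw₁)
      w₁⊥w₂ : Coprime w₁ w₂
      w₁⊥w₂ = distinct-primes-coprime (proj₁ aw₁) (proj₁ aw₂) (proj₁ (proj₂ (proj₂ w-sound)))

      det : ℕ × ℕ → ℕ
      det (v₁ , v₂) = v₁ * w₂ + (m ∸ v₂ * w₁)

      det-ℤ : ∀ {v₁ v₂} → (v₁ , v₂) ∈ Z → + det (v₁ , v₂) ≡ + v₁ ℤ.* + w₂ ℤ.+ (+ m ℤ.- + v₂ ℤ.* + w₁)
      det-ℤ {v₁} {v₂} v∈ = trans (pos-*-+ v₁ w₂ _) (cong (ℤ._+_ (+ v₁ ℤ.* + w₂))
        (trans (sym (ℤ.⊖-≥ v₂w₁≤m)) (trans (sym (ℤ.m-n≡m⊖n m (v₂ * w₁))) (cong (ℤ._-_ (+ m)) (ℤ.pos-* v₂ w₁)))))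
        where v₂w₁≤m = *-≤-of-squares v₂ w₁ (proj₂ (proj₂ (proj₁ (proj₂ (Z-sound v∈))))) (proj₂ (proj₂ aw₁))

      -- Both products are at most m, and v₂ w₁ ≥ 1 makes the total strictly less than 2 m = 2 d e;
      -- hence 2 d possible labels.
      into : ∀ {v} → v ∈ Z → det v / e ∈ upTo (2 * d)
      into {v₁ , v₂} v∈ = ∈-upTo⁺ (m<n*o⇒m/o<n (begin-strict
        v₁ * w₂ + (m ∸ v₂ * w₁)   <⟨ ℕ.+-mono-≤-< (*-≤-of-squares v₁ w₂ (proj₂ (proj₂ av₁)) (proj₂ (proj₂ aw₂)))
                                       (ℕ.∸-monoʳ-< {m} {v₂ * w₁} {0} (ℕ.*-mono-≤ {1} {v₂} {1} (1≤prime (proj₁ av₂)) (1≤prime (proj₁ aw₁)))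
                                         (*-≤-of-squares v₂ w₁ (proj₂ (proj₂ av₂)) (proj₂ (proj₂ aw₁)))) ⟩
        m + m                     ≡⟨ cong₂ _+_ de≡m de≡m ⟨
        d * e + d * e             ≡⟨ ring d e ⟩
        2 * d * e                 ∎))
        where
        open ≤-Reasoning
        av₁ = proj₁ (Z-sound v∈)
        av₂ = proj₁ (proj₂ (Z-sound v∈))
        ring : ∀ d e → d * e + d * e ≡ 2 * d * e
        ring = ℕ-solve

      -- Eliminating y from the congruences of v and w gives m ∣ x (v₁ w₂ - v₂ w₁). With x = d j and
      -- m = d e the factor d cancels, and j is a unit mod e.
      e∣det : ∀ {v} → v ∈ Z → + e ∣ + det v
      e∣det {v₁ , v₂} v∈ = subst (+ e ∣_) (sym (det-ℤ v∈)) (∣-combination (+ 1) (+ d)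
          (coprime-cancel (Coprime.sym e⊥j) (ℤ.*-cancelˡ-∣ (+ d)
            (subst₂ _∣_ (trans (cong +_ (sym de≡m)) (ℤ.pos-* d e)) refl
              (∣-combination (+ w₂) (ℤ.- + v₂) (proj₂ (proj₂ (proj₂ (Z-sound v∈)))) m∣w
                (trans (sym (ℤ.*-assoc (+ d) (+ j) _)) (trans (cong (ℤ._* (+ v₁ ℤ.* + w₂ ℤ.- + v₂ ℤ.* + w₁))
                  (trans (sym (ℤ.pos-* d j)) (cong +_ dj≡x))) (ring₁ (+ x) y (+ v₁) (+ v₂) (+ w₁) (+ w₂))))))))
          ℤ.∣-refl
          (trans (cong (λ m → + v₁ ℤ.* + w₂ ℤ.+ (m ℤ.- + v₂ ℤ.* + w₁)) (trans (cong +_ (sym de≡m)) (ℤ.pos-* d e)))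
            (ring₂ (+ v₁ ℤ.* + w₂) (+ v₂ ℤ.* + w₁) (+ d) (+ e))))
        where
        ring₁ : ∀ x y v₁ v₂ w₁ w₂ → x ℤ.* (v₁ ℤ.* w₂ ℤ.- v₂ ℤ.* w₁)
          ≡ w₂ ℤ.* (v₁ ℤ.* x ℤ.- v₂ ℤ.* y) ℤ.+ (ℤ.- v₂) ℤ.* (w₁ ℤ.* x ℤ.- w₂ ℤ.* y)
        ring₁ = ℤ-solve
        ring₂ : ∀ a b d e → a ℤ.+ (d ℤ.* e ℤ.- b) ≡ + 1 ℤ.* (a ℤ.- b) ℤ.+ d ℤ.* e
        ring₂ = ℤ-solve

      inj : ∀ {u v} → u ∈ Z → v ∈ Z → det u / e ≡ det v / e → u ≡ v
      inj {u₁ , u₂} {v₁ , v₂} u∈ v∈ eq = cong₂ _,_ u₁≡v₁ u₂≡v₂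
        where
        det≡ : + u₁ ℤ.* + w₂ ℤ.+ (+ m ℤ.- + u₂ ℤ.* + w₁) ≡ + v₁ ℤ.* + w₂ ℤ.+ (+ m ℤ.- + v₂ ℤ.* + w₁)
        det≡ = trans (sym (det-ℤ u∈)) (trans (ℤ.i-j≡0⇒i≡j _ _ (small-multiple
          (∣-combination (+ 1) (ℤ.- + 1) (e∣det u∈) (e∣det v∈) (ring (+ det (u₁ , u₂)) (+ det (v₁ , v₂))))
          (same-quotient {det (u₁ , u₂)} {det (v₁ , v₂)} eq))) (det-ℤ v∈))
          where
          ring : ∀ a b → a ℤ.- b ≡ + 1 ℤ.* a ℤ.+ (ℤ.- + 1) ℤ.* b
          ring = ℤ-solve
        difference : + w₂ ℤ.* (+ u₁ ℤ.- + v₁) ≡ (+ u₂ ℤ.- + v₂) ℤ.* + w₁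
        difference = begin
          + w₂ ℤ.* (+ u₁ ℤ.- + v₁)    ≡⟨ ring (+ u₁) (+ u₂) (+ v₁) (+ v₂) (+ w₁) (+ w₂) (+ m) ⟩
          (+ u₁ ℤ.* + w₂ ℤ.+ (+ m ℤ.- + u₂ ℤ.* + w₁)) ℤ.- (+ v₁ ℤ.* + w₂ ℤ.+ (+ m ℤ.- + v₂ ℤ.* + w₁)) ℤ.+ (+ u₂ ℤ.- + v₂) ℤ.* + w₁
            ≡⟨ cong (ℤ._+ (+ u₂ ℤ.- + v₂) ℤ.* + w₁) (ℤ.i≡j⇒i-j≡0 det≡) ⟩
          0ℤ ℤ.+ (+ u₂ ℤ.- + v₂) ℤ.* + w₁   ≡⟨ ℤ.+-identityˡ _ ⟩
          (+ u₂ ℤ.- + v₂) ℤ.* + w₁    ∎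
          where
          open ≡-Reasoning
          ring : ∀ u₁ u₂ v₁ v₂ w₁ w₂ m → w₂ ℤ.* (u₁ ℤ.- v₁) ≡
            (u₁ ℤ.* w₂ ℤ.+ (m ℤ.- u₂ ℤ.* w₁)) ℤ.- (v₁ ℤ.* w₂ ℤ.+ (m ℤ.- v₂ ℤ.* w₁)) ℤ.+ (u₂ ℤ.- v₂) ℤ.* w₁
          ring = ℤ-solve
        u₁≡v₁ : u₁ ≡ v₁
        u₁≡v₁ = residue-unique⁺ (1≤prime (proj₁ (proj₁ (Z-sound u∈)))) (w-max u∈)
          (1≤prime (proj₁ (proj₁ (Z-sound v∈)))) (w-max v∈)
          (coprime-cancel (Coprime.sym w₁⊥w₂) (divides (+ u₂ ℤ.- + v₂) difference))
        u₂≡v₂ : u₂ ≡ v₂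
        u₂≡v₂ = ℤ.+-injective (ℤ.i-j≡0⇒i≡j _ _ (ℤ.*-cancelʳ-≡ (+ u₂ ℤ.- + v₂) 0ℤ (+ w₁)
          (trans (sym difference) (trans (cong (λ u → + w₂ ℤ.* (+ u ℤ.- + v₁)) u₁≡v₁)
            (trans (cong (ℤ._*_ (+ w₂)) (ℤ.i≡j⇒i-j≡0 {+ v₁} refl)) (ℤ.*-zeroʳ (+ w₂)))))))

  -- Counting pairs by common divisors, and exchanging the summations

  Indices : ℕ → List ((ℕ × ℕ) × ℕ × ℕ)
  Indices m = cartesianProduct (factorizations m) (cartesianProduct ⟦1⋯ m ⟧ ⟦1⋯ m ⟧)

  -- The conditions d ∣ x and d ∣ r carry their quotients j and k, so that the sums over x
  -- and r collapse once the order of summation is exchanged.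
  common-divisors : ℕ → ℕ → ℕ → ℕ
  common-divisors m x r = ∑[ ((d , e) , j , k) ∈ Indices m ] 𝟙 (x ℕ.≟ d * j) * (𝟙 (r ℕ.≟ d * k) * (2 * d))

  ≤-common-divisors : ∀ {m x r d e j k} → 0 < m → 1 ≤ x → x ≤ m → 1 ≤ r → r ≤ m → d * e ≡ m → x ≡ d * j → r ≡ d * k →
    2 * d ≤ common-divisors m x r
  ≤-common-divisors {m} {x} {r} {d} {e} {j} {k} 0<m 1≤x x≤m 1≤r r≤m de≡m x≡dj r≡dk = begin
    2 * d                                                    ≡⟨ trans (ℕ.*-identityˡ _) (ℕ.*-identityˡ _) ⟨
    1 * (1 * (2 * d))                                        ≡⟨ cong₂ (λ a b → a * (b * (2 * d))) (𝟙-yes (x ℕ.≟ d * j) x≡dj) (𝟙-yes (r ℕ.≟ d * k) r≡dk) ⟨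
    𝟙 (x ℕ.≟ d * j) * (𝟙 (r ℕ.≟ d * k) * (2 * d))            ≤⟨ ≤-∑ (λ ((d , e) , j , k) → 𝟙 (x ℕ.≟ d * j) * (𝟙 (r ℕ.≟ d * k) * (2 * d)))
                                                                  (∈-cartesianProduct⁺ (∈-factorizations⁺ {d = d} {e} 0<m de≡m) (∈-cartesianProduct⁺ (quotient∈ 1≤x x≤m x≡dj) (quotient∈ 1≤r r≤m r≡dk))) ⟩
    common-divisors m x r                                    ∎
    where
    open ≤-Reasoning
    quotient∈ : ∀ {x j} → 1 ≤ x → x ≤ m → x ≡ d * j → j ∈ ⟦1⋯ m ⟧
    quotient∈ {x} {j} 1≤x x≤m refl = ∈-1⋯⁺ (ℕ.>-nonZero⁻¹ j) (ℕ.≤-trans (ℕ.m≤n*m j d) x≤m)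
      where
      instance
        x≢0 = ℕ.>-nonZero 1≤x
        d≢0 = ℕ.m*n≢0⇒m≢0 d
        j≢0 = ℕ.m*n≢0⇒n≢0 d

  -- Take d = gcd (x , m). As soon as one solution w exists, d divides w₂ y, and w₂ is coprime to d,
  -- so d ∣ y and the term of d occurs among the common divisors. An empty `Z` needs no such term.
  proportional-pairs-≤-divisors : ∀ {m x y} .{{_ : NonZero m}} → 1 ≤ x → x ≤ m → 0 < ∣ y ∣ → ∣ y ∣ ≤ m →
    ∀ {Z} → Unique Z →
    (∀ {v₁ v₂} → (v₁ , v₂) ∈ Z → Admissible m v₁ × Admissible m v₂ × v₁ ≢ v₂ × + m ∣ + v₁ ℤ.* + x ℤ.- + v₂ ℤ.* y) →
    length Z ≤ common-divisors m x ∣ y ∣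
  proportional-pairs-≤-divisors _ _ _ _ {[]} _ _ = z≤n
  proportional-pairs-≤-divisors {m} {x} {y} 1≤x x≤m 0<y y≤m {z ∷ zs} Z-unique Z-sound =
    ℕ.≤-trans (proportional-pairs-≤ {x = x} {y} 1≤x x≤m 0<y y≤m Z-unique Z-sound {d = d} {e} {j} w∈ w-max (sym m≡) (sym x≡) e⊥j)
      (≤-common-divisors {d = d} {e} {j} {k} (ℕ.>-nonZero⁻¹ m) 1≤x x≤m 0<y y≤m (sym m≡) x≡ y≡)
    where
    top = maximum proj₁ z zs
    w₁ = proj₁ (proj₁ top)
    w₂ = proj₂ (proj₁ top)
    w∈ = proj₁ (proj₂ top)
    w-max : ∀ {v} → v ∈ (z ∷ zs) → proj₁ v ≤ w₁
    w-max = proj₂ (proj₂ top)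
    split = gcd-split x m
    d = proj₁ split
    j = proj₁ (proj₂ split)
    e = proj₁ (proj₂ (proj₂ split))
    x≡ : x ≡ d * j
    x≡ = trans (proj₁ (proj₂ (proj₂ (proj₂ split)))) (ℕ.*-comm j d)
    m≡ : m ≡ d * e
    m≡ = trans (proj₁ (proj₂ (proj₂ (proj₂ (proj₂ split))))) (ℕ.*-comm e d)
    e⊥j : Coprime e j
    e⊥j = proj₂ (proj₂ (proj₂ (proj₂ (proj₂ split))))
    w-sound = Z-sound w∈
    d∣m : d ℕ.∣ m
    d∣m = ℕ.divides e (trans m≡ (ℕ.*-comm d e))
    w₂⊥d : Coprime w₂ d
    w₂⊥d (k∣w₂ , k∣d) = proj₁ (proj₂ (proj₁ (proj₂ w-sound))) (k∣w₂ , ℕ.∣-trans k∣d d∣m)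
    d∣y : + d ∣ y
    d∣y = coprime-cancel w₂⊥d (∣-combination (ℤ.- + 1) (+ w₁) (ℤ.∣-trans (∣ᵤ⇒∣ {+ d} {+ m} d∣m) (proj₂ (proj₂ (proj₂ w-sound))))
      (∣ᵤ⇒∣ {+ d} {+ x} (ℕ.divides j (trans x≡ (ℕ.*-comm d j)))) (ring (+ w₁) (+ w₂) (+ x) y))
      where
      ring : ∀ w₁ w₂ x y → w₂ ℤ.* y ≡ (ℤ.- + 1) ℤ.* (w₁ ℤ.* x ℤ.- w₂ ℤ.* y) ℤ.+ w₁ ℤ.* x
      ring = ℤ-solve
    k = ℕ.quotient (∣⇒∣ᵤ d∣y)
    y≡ : ∣ y ∣ ≡ d * k
    y≡ = trans (ℕ._∣_.equality (∣⇒∣ᵤ d∣y)) (ℕ.*-comm k d)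

  off-diagonal : List ℕ → List (ℕ × ℕ)
  off-diagonal V = filter (λ (v₁ , v₂) → ¬? (v₁ ℕ.≟ v₂)) (cartesianProduct V V)

  off-diagonal-cost-∑ : ∀ m V → off-diagonal-cost m V ≡ ∑[ (v₁ , v₂) ∈ off-diagonal V ] total-cost m v₁ v₂
  off-diagonal-cost-∑ m V = sym (trans (∑-filter (λ (v₁ , v₂) → ¬? (v₁ ℕ.≟ v₂)) (cartesianProduct V V) _) (∑-cartesianProduct V V _))

  -- Moving the sum over (v₁ , v₂) innermost turns it, for fixed x and signed r, into the number of
  -- proportional pairs.
  off-diagonal-cost-≤ : ∀ {m V} .{{_ : NonZero m}} → Unique V → All (Admissible m) V →
    off-diagonal-cost m V ≤ ∑[ x ∈ ⟦1⋯ m ⟧ ] ∑[ r ∈ ⟦1⋯ m ⟧ ] 2 * (common-divisors m x r * (m ÷ (x * r)))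
  off-diagonal-cost-≤ {m} {V} V-unique V-admissible = begin
    off-diagonal-cost m V                                           ≡⟨ off-diagonal-cost-∑ m V ⟩
    ∑[ v ∈ OD ] ∑[ x ∈ R ] ∑[ r ∈ R ] ∑[ ± ∈ signs ] f v x r ±      ≡⟨ ∑-swap OD R _ ⟩
    ∑[ x ∈ R ] ∑[ v ∈ OD ] ∑[ r ∈ R ] ∑[ ± ∈ signs ] f v x r ±      ≡⟨ ∑-cong R (λ {x} _ → trans (∑-swap OD R _) (∑-cong R λ {r} _ → ∑-swap OD signs (λ v ± → f v x r ±))) ⟩
    ∑[ x ∈ R ] ∑[ r ∈ R ] ∑[ ± ∈ signs ] ∑[ v ∈ OD ] f v x r ±      ≤⟨ ∑-mono R (λ {x} x∈ → ∑-mono R λ {r} r∈ → ∑-mono signs λ {±} ±∈ → bound x∈ r∈ ±∈) ⟩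
    -- Both signs have the same bound; the sum over the two-element list `signs` unfolds to a + (a +
    -- 0), which is 2 * a by computation.
    ∑[ x ∈ R ] ∑[ r ∈ R ] ∑[ ± ∈ signs ] common-divisors m x r * (m ÷ (x * r)) ≡⟨⟩
    ∑[ x ∈ R ] ∑[ r ∈ R ] 2 * (common-divisors m x r * (m ÷ (x * r))) ∎
    where
    open ≤-Reasoning
    OD = off-diagonal V
    R = ⟦1⋯ m ⟧
    Related : ℕ → ℤ → ℕ × ℕ → Set
    Related x y (v₁ , v₂) = + m ∣ + v₁ ℤ.* + x ℤ.- + v₂ ℤ.* y
    Related? : ∀ x y → Decidable (Related x y)
    Related? x y (v₁ , v₂) = + m ∣? + v₁ ℤ.* + x ℤ.- + v₂ ℤ.* y
    f : ℕ × ℕ → ℕ → ℕ → (ℕ → ℤ) → ℕ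
    f v x r ± = 𝟙 (Related? x (± r) v) * (m ÷ (x * r))
    count : ∀ {x y} → x ∈ R → ∣ y ∣ ∈ R → ∑[ v ∈ OD ] 𝟙 (Related? x y v) ≤ common-divisors m x ∣ y ∣
    count {x} {y} x∈ y∈ = subst (_≤ common-divisors m x ∣ y ∣) (length-filter (Related? x y) OD)
      (proportional-pairs-≤-divisors (proj₁ (∈-1⋯⁻ x∈)) (proj₂ (∈-1⋯⁻ x∈)) (proj₁ (∈-1⋯⁻ y∈)) (proj₂ (∈-1⋯⁻ y∈))
        (Unique.filter⁺ (Related? x y) (Unique.filter⁺ _ (Unique.cartesianProduct⁺ V-unique V-unique))) sound)
      where
      sound : ∀ {v₁ v₂} → (v₁ , v₂) ∈ filter (Related? x y) OD → Admissible m v₁ × Admissible m v₂ × v₁ ≢ v₂ × Related x y (v₁ , v₂)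
      sound v∈ =
        let v∈OD , p = ∈-filter⁻ (Related? x y) {xs = OD} v∈
            v∈V² , v₁≢v₂ = ∈-filter⁻ (λ (v₁ , v₂) → ¬? (v₁ ℕ.≟ v₂)) {xs = cartesianProduct V V} v∈OD
            v₁∈ , v₂∈ = ∈-cartesianProduct⁻ V V v∈V²
        in All.lookup V-admissible v₁∈ , All.lookup V-admissible v₂∈ , v₁≢v₂ , p
    abs-sign : ∀ {± r} → ± ∈ signs → ∣ ± r ∣ ≡ r
    abs-sign (here refl)         = refl
    abs-sign {r = r} (there (here refl)) = ℤ.∣-i∣≡∣i∣ (+ r)
    bound : ∀ {x r ±} → x ∈ R → r ∈ R → ± ∈ signs → ∑[ v ∈ OD ] f v x r ± ≤ common-divisors m x r * (m ÷ (x * r))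
    bound {x} {r} {±} x∈ r∈ ±∈ = begin
      ∑[ v ∈ OD ] f v x r ±                              ≡⟨ ∑-*ʳ OD (m ÷ (x * r)) _ ⟩
      (∑[ v ∈ OD ] 𝟙 (Related? x (± r) v)) * (m ÷ (x * r))     ≤⟨ ℕ.*-monoˡ-≤ (m ÷ (x * r)) (count {x} {± r} x∈ (subst (_∈ R) (sym (abs-sign ±∈)) r∈)) ⟩
      common-divisors m x ∣ ± r ∣ * (m ÷ (x * r))        ≡⟨ cong (λ r′ → common-divisors m x r′ * (m ÷ (x * r))) (abs-sign ±∈) ⟩
      common-divisors m x r * (m ÷ (x * r))              ∎

  -- Reduction to a double sum of quotients

  ∑-pick : ∀ {xs : List ℕ} a (g : ℕ → ℕ) → Unique xs → ∑[ x ∈ xs ] 𝟙 (x ℕ.≟ a) * g x ≤ g a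
  ∑-pick {xs} a g xs-unique = begin
    ∑[ x ∈ xs ] 𝟙 (x ℕ.≟ a) * g x     ≡⟨ ∑-cong xs (λ {x} _ → at-a x) ⟩
    ∑[ x ∈ xs ] 𝟙 (x ℕ.≟ a) * g a     ≡⟨ ∑-*ʳ xs (g a) _ ⟩
    (∑[ x ∈ xs ] 𝟙 (x ℕ.≟ a)) * g a   ≤⟨ ℕ.*-monoˡ-≤ (g a) (∑-𝟙-≤1 (ℕ._≟ a) xs-unique λ _ _ p q → trans p (sym q)) ⟩
    1 * g a                           ≡⟨ ℕ.*-identityˡ (g a) ⟩
    g a                               ∎
    where
    open ≤-Reasoning
    at-a : ∀ x → 𝟙 (x ℕ.≟ a) * g x ≡ 𝟙 (x ℕ.≟ a) * g a
    at-a x with x ℕ.≟ a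
    ... | yes refl = refl
    ... | no _     = refl

  ∑-quotients : ℕ → ℕ
  ∑-quotients m = ∑[ j ∈ ⟦1⋯ m ⟧ ] ∑[ k ∈ ⟦1⋯ m ⟧ ] m ÷ (j * k)

  -- For a fixed index the indicators leave only x = d j and r = d k. The result is an inequality
  -- since these may lie beyond m.
  ∑-common-divisors-≤ : ∀ m → ∑[ x ∈ ⟦1⋯ m ⟧ ] ∑[ r ∈ ⟦1⋯ m ⟧ ] common-divisors m x r * (m ÷ (x * r)) ≤
    ∑[ ((d , e) , j , k) ∈ Indices m ] 2 * d * (m ÷ (d * j * (d * k)))
  ∑-common-divisors-≤ m = begin
    ∑[ x ∈ R ] ∑[ r ∈ R ] common-divisors m x r * F x r
      ≡⟨ ∑-cong R (λ {x} _ → ∑-cong R λ {r} _ → sym (∑-*ʳ T (F x r) _)) ⟩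
    ∑[ x ∈ R ] ∑[ r ∈ R ] ∑[ t ∈ T ] G t x r * F x r
      ≡⟨ trans (∑-cong R λ {x} _ → ∑-swap R T _) (∑-swap R T _) ⟩
    ∑[ t ∈ T ] ∑[ x ∈ R ] ∑[ r ∈ R ] G t x r * F x r
      ≤⟨ ∑-mono T (λ {t} _ → pick t) ⟩
    ∑[ ((d , e) , j , k) ∈ T ] 2 * d * F (d * j) (d * k) ∎
    where
    open ≤-Reasoning
    R = ⟦1⋯ m ⟧
    T = Indices m
    F : ℕ → ℕ → ℕ
    F x r = m ÷ (x * r)
    G : (ℕ × ℕ) × ℕ × ℕ → ℕ → ℕ → ℕ
    G ((d , e) , j , k) x r = 𝟙 (x ℕ.≟ d * j) * (𝟙 (r ℕ.≟ d * k) * (2 * d))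
    pick : ∀ t → ∑[ x ∈ R ] ∑[ r ∈ R ] G t x r * F x r ≤ 2 * proj₁ (proj₁ t) * F (proj₁ (proj₁ t) * proj₁ (proj₂ t)) (proj₁ (proj₁ t) * proj₂ (proj₂ t))
    pick ((d , e) , j , k) = begin
      ∑[ x ∈ R ] ∑[ r ∈ R ] 𝟙 (x ℕ.≟ d * j) * (𝟙 (r ℕ.≟ d * k) * (2 * d)) * F x r
        ≡⟨ ∑-cong R (λ {x} _ → trans (∑-cong R λ {r} _ → assoc (𝟙 (x ℕ.≟ d * j)) (𝟙 (r ℕ.≟ d * k)) (2 * d) (F x r)) (∑-*ˡ R (𝟙 (x ℕ.≟ d * j)) _)) ⟩
      ∑[ x ∈ R ] 𝟙 (x ℕ.≟ d * j) * (∑[ r ∈ R ] 𝟙 (r ℕ.≟ d * k) * (2 * d * F x r))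
        ≤⟨ ∑-mono R (λ {x} _ → ℕ.*-monoʳ-≤ (𝟙 (x ℕ.≟ d * j)) (∑-pick (d * k) _ (1⋯-unique m))) ⟩
      ∑[ x ∈ R ] 𝟙 (x ℕ.≟ d * j) * (2 * d * F x (d * k))
        ≤⟨ ∑-pick (d * j) _ (1⋯-unique m) ⟩
      2 * d * F (d * j) (d * k) ∎
      where
      assoc : ∀ a b c f → a * (b * c) * f ≡ a * (b * (c * f))
      assoc = ℕ-solve

  -- The d in the weight 2 d and the d in φ(m) ≤ d φ(e) together cancel d² in the denominator. The
  -- sum then factors, and ∑ φ(e) ≤ m.
  φ-∑-quotients : ∀ m → φ m * (∑[ ((d , e) , j , k) ∈ Indices m ] 2 * d * (m ÷ (d * j * (d * k)))) ≤ 2 * (m * ∑-quotients m)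
  φ-∑-quotients m = begin
    φ m * (∑[ ((d , e) , j , k) ∈ T ] 2 * d * (m ÷ (d * j * (d * k))))  ≡⟨ ∑-*ˡ T (φ m) _ ⟨
    ∑[ ((d , e) , j , k) ∈ T ] φ m * (2 * d * (m ÷ (d * j * (d * k))))  ≤⟨ ∑-mono T term ⟩
    ∑[ ((d , e) , j , k) ∈ T ] 2 * (φ e * (m ÷ (j * k)))                ≡⟨ ∑-*ˡ T 2 _ ⟩
    2 * (∑[ ((d , e) , j , k) ∈ T ] φ e * (m ÷ (j * k)))                ≡⟨ cong (2 *_) factor ⟩
    2 * ((∑[ (d , e) ∈ factorizations m ] φ e) * ∑-quotients m)         ≤⟨ ℕ.*-monoʳ-≤ 2 (ℕ.*-monoˡ-≤ (∑-quotients m) (∑-φ m)) ⟩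
    2 * (m * ∑-quotients m)                                             ∎
    where
    open ≤-Reasoning
    T = Indices m
    R = ⟦1⋯ m ⟧
    factor : ∑[ ((d , e) , j , k) ∈ T ] φ e * (m ÷ (j * k)) ≡ (∑[ (d , e) ∈ factorizations m ] φ e) * ∑-quotients m
    factor = trans (∑-cartesianProduct (factorizations m) _ _) (trans
      (∑-cong (factorizations m) λ {de} _ → trans (∑-*ˡ (cartesianProduct R R) (φ (proj₂ de)) _) (cong (φ (proj₂ de) *_) (∑-cartesianProduct R R _)))
      (∑-*ʳ (factorizations m) (∑-quotients m) _))
    term : ∀ {t} → t ∈ T → φ m * (2 * proj₁ (proj₁ t) * (m ÷ (proj₁ (proj₁ t) * proj₁ (proj₂ t) * (proj₁ (proj₁ t) * proj₂ (proj₂ t))))) ≤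
      2 * (φ (proj₂ (proj₁ t)) * (m ÷ (proj₁ (proj₂ t) * proj₂ (proj₂ t))))
    term {(d , e) , j , k} t∈
      with de∈ , jk∈ ← ∈-cartesianProduct⁻ (factorizations m) (cartesianProduct R R) t∈
      with j∈ , k∈ ← ∈-cartesianProduct⁻ R R jk∈
      with _ , _ , de≡m ← ∈-factorizations⁻ {m} de∈ = begin
      φ m * (2 * d * Q)          ≤⟨ ℕ.*-monoˡ-≤ (2 * d * Q) (subst (λ n → φ n ≤ d * φ e) de≡m (φ-*-≤ d e)) ⟩
      d * φ e * (2 * d * Q)      ≡⟨ ring₁ d (φ e) Q ⟩
      2 * (φ e * (d * d * Q))    ≤⟨ ℕ.*-monoʳ-≤ 2 (ℕ.*-monoʳ-≤ (φ e) (≤-÷ (ℕ.*-mono-≤ {1} {j} {1} (proj₁ (∈-1⋯⁻ j∈)) (proj₁ (∈-1⋯⁻ k∈)))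
                                      (ℕ.≤-trans (ℕ.≤-reflexive (ring₂ d Q j k)) (÷-*-≤ m (d * j * (d * k)))))) ⟩
      2 * (φ e * (m ÷ (j * k)))  ∎
      where
      Q = m ÷ (d * j * (d * k))
      ring₁ : ∀ d f Q → d * f * (2 * d * Q) ≡ 2 * (f * (d * d * Q))
      ring₁ = ℕ-solve
      ring₂ : ∀ d Q j k → d * d * Q * (j * k) ≡ Q * (d * j * (d * k))
      ring₂ = ℕ-solve

  φ-*-cost-≤ : ∀ {m V} .{{_ : NonZero m}} → Unique V → All (Admissible m) V → φ m * off-diagonal-cost m V ≤ 4 * (m * ∑-quotients m)
  φ-*-cost-≤ {m} {V} V-unique V-admissible = begin
    φ m * off-diagonal-cost m V                                  ≤⟨ ℕ.*-monoʳ-≤ (φ m) (off-diagonal-cost-≤ V-unique V-admissible) ⟩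
    φ m * (∑[ x ∈ R ] ∑[ r ∈ R ] 2 * (common-divisors m x r * (m ÷ (x * r))))
      ≡⟨ cong (φ m *_) (trans (∑-cong R λ {x} _ → ∑-*ˡ R 2 _) (∑-*ˡ R 2 _)) ⟩
    φ m * (2 * (∑[ x ∈ R ] ∑[ r ∈ R ] common-divisors m x r * (m ÷ (x * r))))
      ≤⟨ ℕ.*-monoʳ-≤ (φ m) (ℕ.*-monoʳ-≤ 2 (∑-common-divisors-≤ m)) ⟩
    φ m * (2 * X)                                                ≡⟨ ring₁ (φ m) X ⟩
    2 * (φ m * X)                                                ≤⟨ ℕ.*-monoʳ-≤ 2 (φ-∑-quotients m) ⟩
    2 * (2 * (m * ∑-quotients m))                                ≡⟨ ring₂ (m * ∑-quotients m) ⟩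
    4 * (m * ∑-quotients m)                                      ∎
    where
    open ≤-Reasoning
    R = ⟦1⋯ m ⟧
    X = ∑[ ((d , e) , j , k) ∈ Indices m ] 2 * d * (m ÷ (d * j * (d * k)))
    ring₁ : ∀ a b → a * (2 * b) ≡ 2 * (a * b)
    ring₁ = ℕ-solve
    ring₂ : ∀ a → 2 * (2 * a) ≡ 4 * a
    ring₂ = ℕ-solve

open import Data.Rational.Base using (ℚ; 0ℚ; 1ℚ; _/_; _+_; _-_; -_; _*_; ∣_∣; _≤_; toℚᵘ; NonNegative; nonNegative)
open import Data.Rational.Properties
open import Data.Rational.Solver using (module +-*-Solver)
import Data.Rational.Unnormalised.Base as ℚᵘ
import Data.Rational.Unnormalised.Properties as ℚᵘ

-- Comparison with the logarithm

ι : ℕ → ℚ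
ι n = + n / 1

⅟ : ∀ n .{{_ : NonZero n}} → ℚ
⅟ n = + 1 / n

toℚᵘ-/ : ∀ p d .{{_ : NonZero d}} → toℚᵘ (+ p / d) ℚᵘ.≃ + p ℚᵘ./ d
toℚᵘ-/ p (suc d) = toℚᵘ-fromℚᵘ (ℚᵘ.mkℚᵘ (+ p) d)

ι-+ : ∀ a b → ι (a ℕ.+ b) ≡ ι a + ι b
ι-+ a b = toℚᵘ-injective (begin
  toℚᵘ (ι (a ℕ.+ b))              ≈⟨ toℚᵘ-/ (a ℕ.+ b) 1 ⟩
  + (a ℕ.+ b) ℚᵘ./ 1              ≈⟨ ℚᵘ.*≡* (trans (cong (ℤ._* (+ 1 ℤ.* + 1)) (ℤ.pos-+ a b)) (ring (+ a) (+ b))) ⟩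
  + a ℚᵘ./ 1 ℚᵘ.+ + b ℚᵘ./ 1      ≈⟨ ℚᵘ.+-cong (toℚᵘ-/ a 1) (toℚᵘ-/ b 1) ⟨
  toℚᵘ (ι a) ℚᵘ.+ toℚᵘ (ι b)      ≈⟨ toℚᵘ-homo-+ (ι a) (ι b) ⟨
  toℚᵘ (ι a + ι b)                ∎)
  where
  open import Relation.Binary.Reasoning.Setoid ℚᵘ.≃-setoid
  ring : ∀ a b → (a ℤ.+ b) ℤ.* (+ 1 ℤ.* + 1) ≡ (a ℤ.* + 1 ℤ.+ b ℤ.* + 1) ℤ.* + 1
  ring = ℤ-solve

/-*-/ : ∀ a b c d .{{_ : NonZero c}} .{{_ : NonZero d}} .{{_ : NonZero (c ℕ.* d)}} → + (a ℕ.* b) / (c ℕ.* d) ≡ (+ a / c) * (+ b / d)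
/-*-/ a b c@(suc _) d@(suc _) = toℚᵘ-injective (begin
  toℚᵘ (+ (a ℕ.* b) / (c ℕ.* d))           ≈⟨ toℚᵘ-/ (a ℕ.* b) (c ℕ.* d) ⟩
  + (a ℕ.* b) ℚᵘ./ (c ℕ.* d)               ≈⟨ ℚᵘ.*≡* (cong (ℤ._* + (c ℕ.* d)) (ℤ.pos-* a b)) ⟩
  (+ a ℚᵘ./ c) ℚᵘ.* (+ b ℚᵘ./ d)           ≈⟨ ℚᵘ.*-cong (toℚᵘ-/ a c) (toℚᵘ-/ b d) ⟨
  toℚᵘ (+ a / c) ℚᵘ.* toℚᵘ (+ b / d)       ≈⟨ toℚᵘ-homo-* (+ a / c) (+ b / d) ⟨
  toℚᵘ ((+ a / c) * (+ b / d))             ∎)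
  where open import Relation.Binary.Reasoning.Setoid ℚᵘ.≃-setoid

ι-* : ∀ a b → ι (a ℕ.* b) ≡ ι a * ι b
ι-* a b = /-*-/ a b 1 1

/≡ι*⅟ : ∀ p d .{{_ : NonZero d}} → + p / d ≡ ι p * ⅟ d
/≡ι*⅟ p d@(suc _) = begin
  + p / d                         ≡⟨ /-cong (cong +_ (sym (ℕ.*-identityʳ p))) (sym (ℕ.*-identityˡ d)) ⟩
  + (p ℕ.* 1) / (1 ℕ.* d)         ≡⟨ /-*-/ p 1 1 d ⟩
  ι p * ⅟ d                       ∎
  where open ≡-Reasoning

ι*⅟ : ∀ d .{{_ : NonZero d}} → ι d * ⅟ d ≡ 1ℚ
ι*⅟ d@(suc k) = trans (sym (/≡ι*⅟ d d)) (toℚᵘ-injective (ℚᵘ.≃-trans (toℚᵘ-/ d d)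
  (ℚᵘ.*≡* (trans (ℤ.*-identityʳ (+ d)) (sym (ℤ.*-identityˡ (+ d)))))))

ι-mono : ∀ {a b} → a ℕ.≤ b → ι a ≤ ι b
ι-mono {a} {b} a≤b = toℚᵘ-cancel-≤ (begin
  toℚᵘ (ι a)       ≃⟨ toℚᵘ-/ a 1 ⟩
  + a ℚᵘ./ 1       ≤⟨ ℚᵘ.*≤* (ℤ.*-monoʳ-≤-nonNeg (+ 1) (ℤ.+≤+ a≤b)) ⟩
  + b ℚᵘ./ 1       ≃⟨ toℚᵘ-/ b 1 ⟨
  toℚᵘ (ι b)       ∎)
  where open ℚᵘ.≤-Reasoning

⅟-anti : ∀ {a b} .{{_ : NonZero a}} .{{_ : NonZero b}} → a ℕ.≤ b → ⅟ b ≤ ⅟ a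
⅟-anti {a@(suc _)} {b@(suc _)} a≤b = toℚᵘ-cancel-≤ (begin
  toℚᵘ (⅟ b)       ≃⟨ toℚᵘ-/ 1 b ⟩
  + 1 ℚᵘ./ b       ≤⟨ ℚᵘ.*≤* (ℤ.*-monoˡ-≤-nonNeg (+ 1) (ℤ.+≤+ a≤b)) ⟩
  + 1 ℚᵘ./ a       ≃⟨ toℚᵘ-/ 1 a ⟨
  toℚᵘ (⅟ a)       ∎)
  where open ℚᵘ.≤-Reasoning

/-nonNeg : ∀ p d .{{_ : NonZero d}} → NonNegative (+ p / d)
/-nonNeg p d = normalize-nonNeg p d

0≤/ : ∀ p d .{{_ : NonZero d}} → 0ℚ ≤ + p / d
0≤/ p d = nonNegative⁻¹ (+ p / d) {{/-nonNeg p d}}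

harmonic-nonNeg : ∀ n → NonNegative (harmonic n)
harmonic-nonNeg zero    = _
harmonic-nonNeg (suc n) = nonNeg+nonNeg⇒nonNeg (harmonic n) {{harmonic-nonNeg n}} (⅟ (suc n)) {{/-nonNeg 1 (suc n)}}

ι-÷-≤ : ∀ a k .{{_ : NonZero k}} → ι (a ÷ k) ≤ ι a * ⅟ k
ι-÷-≤ a k = begin
  ι (a ÷ k)                   ≡⟨ trans (sym (*-identityʳ _)) (cong (ι (a ÷ k) *_) (sym (ι*⅟ k))) ⟩
  ι (a ÷ k) * (ι k * ⅟ k)     ≡⟨ *-assoc (ι (a ÷ k)) (ι k) (⅟ k) ⟨
  ι (a ÷ k) * ι k * ⅟ k       ≡⟨ cong (_* ⅟ k) (ι-* (a ÷ k) k) ⟨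
  ι (a ÷ k ℕ.* k) * ⅟ k       ≤⟨ *-monoʳ-≤-nonNeg (⅟ k) {{/-nonNeg 1 k}} (ι-mono (÷-*-≤ a k)) ⟩
  ι a * ⅟ k                   ∎
  where open ≤-Reasoning

∑-÷-≤ : ∀ a n → ι (∑[ k ∈ ⟦1⋯ n ⟧ ] a ÷ k) ≤ ι a * harmonic n
∑-÷-≤ a zero    = ≤-reflexive (sym (*-zeroʳ (ι a)))
∑-÷-≤ a (suc n) = begin
  ι (∑[ k ∈ ⟦1⋯ suc n ⟧ ] a ÷ k)                  ≡⟨ cong ι (∑-1⋯-suc n (a ÷_)) ⟩
  ι ((∑[ k ∈ ⟦1⋯ n ⟧ ] a ÷ k) ℕ.+ a ÷ suc n)      ≡⟨ ι-+ (∑[ k ∈ ⟦1⋯ n ⟧ ] a ÷ k) (a ÷ suc n) ⟩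
  ι (∑[ k ∈ ⟦1⋯ n ⟧ ] a ÷ k) + ι (a ÷ suc n)      ≤⟨ +-mono-≤ (∑-÷-≤ a n) (ι-÷-≤ a (suc n)) ⟩
  ι a * harmonic n + ι a * ⅟ (suc n)              ≡⟨ *-distribˡ-+ (ι a) (harmonic n) (⅟ (suc n)) ⟨
  ι a * harmonic (suc n)                          ∎
  where open ≤-Reasoning

∑-ι-≤ : ∀ (c : ℚ) n {f g : ℕ → ℕ} → (∀ k → ι (f k) ≤ ι (g k) * c) → ι (∑ ⟦1⋯ n ⟧ f) ≤ ι (∑ ⟦1⋯ n ⟧ g) * c
∑-ι-≤ c zero    le = ≤-reflexive (sym (*-zeroˡ c))
∑-ι-≤ c (suc n) {f} {g} le = begin
  ι (∑ ⟦1⋯ suc n ⟧ f)                             ≡⟨ cong ι (∑-1⋯-suc n f) ⟩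
  ι (∑ ⟦1⋯ n ⟧ f ℕ.+ f (suc n))                   ≡⟨ ι-+ (∑ ⟦1⋯ n ⟧ f) (f (suc n)) ⟩
  ι (∑ ⟦1⋯ n ⟧ f) + ι (f (suc n))                 ≤⟨ +-mono-≤ (∑-ι-≤ c n le) (le (suc n)) ⟩
  ι (∑ ⟦1⋯ n ⟧ g) * c + ι (g (suc n)) * c         ≡⟨ *-distribʳ-+ c (ι (∑ ⟦1⋯ n ⟧ g)) (ι (g (suc n))) ⟨
  (ι (∑ ⟦1⋯ n ⟧ g) + ι (g (suc n))) * c           ≡⟨ cong (_* c) (ι-+ (∑ ⟦1⋯ n ⟧ g) (g (suc n))) ⟨
  ι (∑ ⟦1⋯ n ⟧ g ℕ.+ g (suc n)) * c               ≡⟨ cong (λ s → ι s * c) (∑-1⋯-suc n g) ⟨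
  ι (∑ ⟦1⋯ suc n ⟧ g) * c                         ∎
  where open ≤-Reasoning

÷-÷ : ∀ a j k → a ÷ (j ℕ.* k) ℕ.≤ (a ÷ j) ÷ k
÷-÷ a zero    k = z≤n
÷-÷ a (suc j) zero rewrite ℕ.*-zeroʳ j = z≤n
÷-÷ a (suc j) (suc k) = ≤-÷ ℕ.z<s (≤-÷ ℕ.z<s (ℕ.≤-trans (ℕ.≤-reflexive eq) (÷-*-≤ a (suc j ℕ.* suc k))))
  where
  Q = a ÷ (suc j ℕ.* suc k)
  eq : Q ℕ.* suc k ℕ.* suc j ≡ Q ℕ.* (suc j ℕ.* suc k)
  eq = trans (ℕ.*-assoc Q (suc k) (suc j)) (cong (Q ℕ.*_) (ℕ.*-comm (suc k) (suc j)))

-- Nested division: summing (m ÷ j) ÷ k over k costs one harmonic factor, and summing m ÷ j over j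
-- the second.
∑-quotients-≤ : ∀ m → ι (∑-quotients m) ≤ ι m * (harmonic m * harmonic m)
∑-quotients-≤ m = begin
  ι (∑-quotients m)                               ≤⟨ ∑-ι-≤ h m (λ j → ≤-trans (ι-mono (∑-mono ⟦1⋯ m ⟧ λ {k} _ → ÷-÷ m j k)) (∑-÷-≤ (m ÷ j) m)) ⟩
  ι (∑[ j ∈ ⟦1⋯ m ⟧ ] m ÷ j) * h                  ≤⟨ *-monoʳ-≤-nonNeg h {{harmonic-nonNeg m}} (∑-÷-≤ m m) ⟩
  ι m * h * h                                     ≡⟨ *-assoc (ι m) h h ⟩
  ι m * (h * h)                                   ∎
  where
  open ≤-Reasoning
  h = harmonic m

harmonic-block : ∀ k a b .{{_ : NonZero b}} → k ℕ.+ a ℕ.≤ b → harmonic a + ι k * ⅟ b ≤ harmonic (k ℕ.+ a)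
harmonic-block zero    a b _  = ≤-reflexive (trans (cong (_+_ (harmonic a)) (*-zeroˡ (⅟ b))) (+-identityʳ (harmonic a)))
harmonic-block (suc k) a b le = begin
  harmonic a + ι (suc k) * ⅟ b                    ≡⟨ cong (λ n → harmonic a + n * ⅟ b) (ι-+ 1 k) ⟩
  harmonic a + (1ℚ + ι k) * ⅟ b                   ≡⟨ ring (harmonic a) (ι k) (⅟ b) ⟩
  harmonic a + ι k * ⅟ b + ⅟ b                    ≤⟨ +-mono-≤ (harmonic-block k a b (ℕ.<⇒≤ le)) (⅟-anti le) ⟩
  harmonic (suc k ℕ.+ a)                          ∎
  where
  open ≤-Reasoning
  open +-*-Solver
  ring : ∀ h k r → h + (1ℚ + k) * r ≡ h + k * r + r
  ring = solve 3 (λ h k r → h :+ (con 1ℚ :+ k) :* r := h :+ k :* r :+ r) refl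

-- H (N m) − H N splits into the blocks N j < i ≤ N (j + 1), each at least 1 / (j + 1).
harmonic-≤-log-seq : ∀ n m .{{_ : NonZero m}} → harmonic m ≤ 1ℚ + log-seq m n
harmonic-≤-log-seq n 1 = ≤-reflexive (sym (trans (cong (λ k → 1ℚ + (harmonic k - harmonic (suc n))) (ℕ.*-identityʳ (suc n)))
  (cong (_+_ 1ℚ) (+-inverseʳ (harmonic (suc n))))))
harmonic-≤-log-seq n (suc (suc m)) = begin
  harmonic (suc m) + ⅟ M                          ≤⟨ +-monoˡ-≤ (⅟ M) (harmonic-≤-log-seq n (suc m)) ⟩
  1ℚ + (harmonic (N ℕ.* suc m) - harmonic N) + ⅟ M      ≡⟨ ring (harmonic (N ℕ.* suc m)) (harmonic N) (⅟ M) ⟩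
  1ℚ + (harmonic (N ℕ.* suc m) + ⅟ M - harmonic N)      ≤⟨ +-monoʳ-≤ 1ℚ (+-monoˡ-≤ (- harmonic N) step) ⟩
  1ℚ + (harmonic (N ℕ.* M) - harmonic N)          ∎
  where
  open ≤-Reasoning
  open +-*-Solver
  N = suc n
  M = suc (suc m)
  ring : ∀ a b r → 1ℚ + (a - b) + r ≡ 1ℚ + (a + r - b)
  ring = solve 3 (λ a b r → con 1ℚ :+ (a :- b) :+ r := con 1ℚ :+ (a :+ r :- b)) refl
  ιN*⅟NM : ι N * ⅟ (N ℕ.* M) ≡ ⅟ M
  ιN*⅟NM = trans (cong (ι N *_) (/-*-/ 1 1 N M)) (trans (sym (*-assoc (ι N) (⅟ N) (⅟ M)))
    (trans (cong (_* ⅟ M) (ι*⅟ N)) (*-identityˡ (⅟ M))))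
  step : harmonic (N ℕ.* suc m) + ⅟ M ≤ harmonic (N ℕ.* M)
  step = subst₂ _≤_ (cong (_+_ (harmonic (N ℕ.* suc m))) ιN*⅟NM) (cong harmonic (sym (ℕ.*-suc N (suc m))))
    (harmonic-block N (N ℕ.* suc m) (N ℕ.* M) (ℕ.≤-reflexive (sym (ℕ.*-suc N (suc m)))))

harmonic-mono : ∀ d n → harmonic n ≤ harmonic (d ℕ.+ n)
harmonic-mono zero    n = ≤-refl
harmonic-mono (suc d) n = ≤-trans (harmonic-mono d n) (subst (_≤ harmonic (suc d ℕ.+ n)) (+-identityʳ _)
  (+-monoʳ-≤ (harmonic (d ℕ.+ n)) (0≤/ 1 (suc (d ℕ.+ n)))))

-- From H ≥ 2 follows H ≤ 2 (H - 1), and H - 1 is bounded by the logarithm.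
harmonic-≤-2log-seq : ∀ {m} n → 4 ℕ.≤ m → harmonic m ≤ ι 2 * log-seq m n
harmonic-≤-2log-seq {m} n 4≤m = begin
  h                        ≡⟨ ring h ⟩
  ι 2 * (h - 1ℚ) + (ι 2 - h)    ≤⟨ +-monoʳ-≤ (ι 2 * (h - 1ℚ)) (subst (ι 2 - h ≤_) (+-inverseʳ (ι 2)) (+-monoʳ-≤ (ι 2) (neg-antimono-≤ 2≤h))) ⟩
  ι 2 * (h - 1ℚ) + 0ℚ      ≡⟨ +-identityʳ _ ⟩
  ι 2 * (h - 1ℚ)           ≤⟨ *-monoˡ-≤-nonNeg (ι 2) (subst (h - 1ℚ ≤_) (ring′ l) (+-monoˡ-≤ (- 1ℚ) h≤1+l)) ⟩
  ι 2 * l                  ∎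
  where
  open ≤-Reasoning
  open +-*-Solver
  h = harmonic m
  l = log-seq m n
  ring : ∀ h → h ≡ ι 2 * (h - 1ℚ) + (ι 2 - h)
  ring = solve 1 (λ h → h := con (ι 2) :* (h :- con 1ℚ) :+ (con (ι 2) :- h)) refl
  ring′ : ∀ l → 1ℚ + l - 1ℚ ≡ l
  ring′ = solve 1 (λ l → con 1ℚ :+ l :- con 1ℚ := l) refl
  2≤h : ι 2 ≤ h
  -- H(4) = 25/12 is the first harmonic number to reach 2; the comparison is decided by computation.
  2≤h = ≤-trans (≤ᵇ⇒≤ _) (subst (λ k → harmonic 4 ≤ harmonic k) (ℕ.m∸n+n≡m 4≤m) (harmonic-mono (m ℕ.∸ 4) 4))
  h≤1+l : h ≤ 1ℚ + l
  h≤1+l = harmonic-≤-log-seq n m {{ℕ.>-nonZero (ℕ.≤-trans (s≤s z≤n) 4≤m)}}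

-- Division by m and the final bound

difference-≤ : ∀ {a b ε} → a ℕ.≤ b ℕ.+ ε → ι a - ι b ≤ ι ε
difference-≤ {a} {b} {ε} le = ≤-trans (+-monoˡ-≤ (- ι b) (subst (ι a ≤_) (ι-+ b ε) (ι-mono le))) (≤-reflexive (ring (ι b) (ι ε)))
  where
  open +-*-Solver
  ring : ∀ b e → b + e - b ≡ e
  ring = solve 2 (λ b e → b :+ e :- b := e) refl

Estimate-ι : ∀ {X Y ε} → Estimate X Y ε → ∣ ι X - ι Y ∣ ≤ ι ε
Estimate-ι {X} {Y} {ε} (X≤Y+ε , Y≤X+ε) with ∣p∣≡p∨∣p∣≡-p (ι X - ι Y)
... | inj₁ eq = ≤-trans (≤-reflexive eq) (difference-≤ {X} {Y} X≤Y+ε)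
... | inj₂ eq = ≤-trans (≤-reflexive (trans eq (neg-swap (ι X) (ι Y)))) (difference-≤ {Y} {X} Y≤X+ε)
  where
  open +-*-Solver
  neg-swap : ∀ a b → - (a - b) ≡ b - a
  neg-swap = solve 2 (λ a b → :- (a :- b) := b :- a) refl

-- Both sides of the natural-number estimate are divided by m: the difference becomes J minus the
-- main terms, and the error 2 m · cost becomes 2 · cost.
J-error-≤ : ∀ {m V S L} .{{_ : NonZero m}} → Unique V → All (Admissible m) V → L ℕ.≤ m →
  let #V = length V ; main = (+ (#V ^ 2 ℕ.* L ^ 2) / m + + (#V ℕ.* L) / 1) - + (#V ℕ.* L ^ 2) / m in
  ∣ ι (J m V S L) - main ∣ ≤ ι (2 ℕ.* off-diagonal-cost m V)
J-error-≤ {m} {V} {S} {L} V-unique V-admissible L≤m = begin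
  ∣ ι j - ((+ (#V ^ 2 ℕ.* L ^ 2) / m + ι (#V ℕ.* L)) - + (#V ℕ.* L ^ 2) / m) ∣   ≡⟨ cong ∣_∣ scaled ⟩
  ∣ (ι X - ι Y) * r ∣                     ≡⟨ ∣p*q∣≡∣p∣*∣q∣ (ι X - ι Y) r ⟩
  ∣ ι X - ι Y ∣ * ∣ r ∣                   ≡⟨ cong (∣ ι X - ι Y ∣ *_) (0≤p⇒∣p∣≡p (0≤/ 1 m)) ⟩
  ∣ ι X - ι Y ∣ * r                       ≤⟨ *-monoʳ-≤-nonNeg r {{/-nonNeg 1 m}} (Estimate-ι {X} {Y} (J-estimate {S = S} V-unique (All.map (λ a → proj₁ (proj₂ a)) V-admissible) L≤m)) ⟩
  ι (2 ℕ.* m ℕ.* E) * r                   ≡⟨ cong (λ n → ι n * r) (trans (ℕ.*-assoc 2 m E) (trans (cong (2 ℕ.*_) (ℕ.*-comm m E)) (sym (ℕ.*-assoc 2 E m)))) ⟩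
  ι (2 ℕ.* E ℕ.* m) * r                   ≡⟨ cong (_* r) (ι-* (2 ℕ.* E) m) ⟩
  ι (2 ℕ.* E) * ι m * r                   ≡⟨ trans (*-assoc (ι (2 ℕ.* E)) (ι m) r) (trans (cong (ι (2 ℕ.* E) *_) (ι*⅟ m)) (*-identityʳ _)) ⟩
  ι (2 ℕ.* E)                             ∎
  where
  open ≤-Reasoning
  #V = length V
  j = J m V S L
  r = ⅟ m
  E = off-diagonal-cost m V
  X = m ℕ.* j ℕ.+ #V ℕ.* (L ℕ.* L)
  Y = #V ℕ.* #V ℕ.* (L ℕ.* L) ℕ.+ #V ℕ.* (m ℕ.* L)
  square : ∀ n → n ^ 2 ≡ n ℕ.* n
  square n = cong (n ℕ.*_) (ℕ.*-identityʳ n)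
  ιX : ι X ≡ ι m * ι j + ι (#V ℕ.* L ^ 2)
  ιX = trans (ι-+ (m ℕ.* j) _) (cong₂ _+_ (ι-* m j) (cong (λ k → ι (#V ℕ.* k)) (sym (square L))))
  ιY : ι Y ≡ ι (#V ^ 2 ℕ.* L ^ 2) + ι m * ι (#V ℕ.* L)
  ιY = trans (ι-+ (#V ℕ.* #V ℕ.* (L ℕ.* L)) _) (cong₂ _+_ (cong₂ (λ a b → ι (a ℕ.* b)) (sym (square #V)) (sym (square L)))
    (trans (cong ι (trans (sym (ℕ.*-assoc #V m L)) (trans (cong (ℕ._* L) (ℕ.*-comm #V m)) (ℕ.*-assoc m #V L)))) (ι-* m (#V ℕ.* L))))
  ring : ∀ M j a b k r → (M * j + a - (b + M * k)) * r ≡ M * r * (j - k) - (b * r - a * r)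
  ring = solve 6 (λ M j a b k r → (M :* j :+ a :- (b :+ M :* k)) :* r := M :* r :* (j :- k) :- (b :* r :- a :* r)) refl
    where open +-*-Solver
  ring′ : ∀ j a b k → 1ℚ * (j - k) - (b - a) ≡ j - ((b + k) - a)
  ring′ = solve 4 (λ j a b k → con 1ℚ :* (j :- k) :- (b :- a) := j :- ((b :+ k) :- a)) refl
    where open +-*-Solver
  scaled : ι j - ((+ (#V ^ 2 ℕ.* L ^ 2) / m + ι (#V ℕ.* L)) - + (#V ℕ.* L ^ 2) / m) ≡ (ι X - ι Y) * r
  scaled = sym (begin-equality
    (ι X - ι Y) * r      ≡⟨ cong₂ (λ a b → (a - b) * r) ιX ιY ⟩
    (ι m * ι j + a - (b + ι m * k)) * r          ≡⟨ ring (ι m) (ι j) a b k r ⟩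
    ι m * r * (ι j - k) - (b * r - a * r)        ≡⟨ cong (λ u → u * (ι j - k) - (b * r - a * r)) (ι*⅟ m) ⟩
    1ℚ * (ι j - k) - (b * r - a * r)             ≡⟨ cong₂ (λ b a → 1ℚ * (ι j - k) - (b - a)) (/≡ι*⅟ (#V ^ 2 ℕ.* L ^ 2) m) (/≡ι*⅟ (#V ℕ.* L ^ 2) m) ⟨
    1ℚ * (ι j - k) - (+ (#V ^ 2 ℕ.* L ^ 2) / m - + (#V ℕ.* L ^ 2) / m)   ≡⟨ ring′ (ι j) (+ (#V ℕ.* L ^ 2) / m) (+ (#V ^ 2 ℕ.* L ^ 2) / m) k ⟩
    ι j - ((+ (#V ^ 2 ℕ.* L ^ 2) / m + k) - + (#V ℕ.* L ^ 2) / m)        ∎)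
    where
    a = ι (#V ℕ.* L ^ 2)
    b = ι (#V ^ 2 ℕ.* L ^ 2)
    k = ι (#V ℕ.* L)

0≤log-seq : ∀ m n .{{_ : NonZero m}} → 0ℚ ≤ log-seq m n
0≤log-seq m@(suc k) n = subst₂ _≤_ (+-inverseʳ 1ℚ) (ring (log-seq m n)) (+-monoˡ-≤ (- 1ℚ)
  (≤-trans (subst (λ i → 1ℚ ≤ harmonic i) (ℕ.+-comm k 1) (harmonic-mono k 1)) (harmonic-≤-log-seq n m)))
  where
  open +-*-Solver
  ring : ∀ l → 1ℚ + l - 1ℚ ≡ l
  ring = solve 1 (λ l → con 1ℚ :+ l :- con 1ℚ := l) refl

square-mono : ∀ {p q} → 0ℚ ≤ p → p ≤ q → p * p ≤ q * q
square-mono {p} {q} 0≤p p≤q = ≤-trans (*-monoˡ-≤-nonNeg p {{nonNegative 0≤p}} p≤q) (*-monoʳ-≤-nonNeg q {{nonNegative (≤-trans 0≤p p≤q)}} p≤q)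

cost-≤-log : ∀ {m V} .{{_ : NonZero m}} → Unique V → All (Admissible m) V → ∀ n →
  ι (2 ℕ.* off-diagonal-cost m V) ≤ ι 32 * (+ (m ^ 2) / φ m) {{φ-nonZero m}} * (log-seq m n * log-seq m n)
-- For m < 4 no prime has square at most m, so only empty V occurs; there the logarithm may vanish
-- (m = 1), but so does the cost.
cost-≤-log {m} {[]} _ _ n = nonNegative⁻¹ _ {{nonNeg*nonNeg⇒nonNeg (ι 32 * M) {{nonNeg*nonNeg⇒nonNeg (ι 32) M {{/-nonNeg (m ^ 2) (φ m)}}}} (l * l) {{nonNeg*nonNeg⇒nonNeg l l}}}}
  where
  instance _ = φ-nonZero m
  M = + (m ^ 2) / φ m
  l = log-seq m n
  instance _ = nonNegative (0≤log-seq m n)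
cost-≤-log {m} {V@(v ∷ _)} V-unique V-admissible@((v-prime , _ , v²≤m) ∷ _) n = begin
  ι (2 ℕ.* E)                                       ≡⟨ trans (sym (*-identityʳ _)) (cong (ι (2 ℕ.* E) *_) (sym (ι*⅟ (φ m)))) ⟩
  ι (2 ℕ.* E) * (ι (φ m) * s)                       ≡⟨ *-assoc (ι (2 ℕ.* E)) (ι (φ m)) s ⟨
  ι (2 ℕ.* E) * ι (φ m) * s                         ≡⟨ cong (_* s) (ι-* (2 ℕ.* E) (φ m)) ⟨
  ι (2 ℕ.* E ℕ.* φ m) * s                           ≤⟨ *-monoʳ-≤-nonNeg s (ι-mono (ℕ.≤-trans (ℕ.≤-reflexive (trans (ℕ.*-assoc 2 E (φ m)) (cong (2 ℕ.*_) (ℕ.*-comm E (φ m)))))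
                                                         (ℕ.*-monoʳ-≤ 2 (φ-*-cost-≤ V-unique V-admissible)))) ⟩
  ι (2 ℕ.* (4 ℕ.* (m ℕ.* ∑-quotients m))) * s       ≡⟨ cong (_* s) (trans (ι-* 2 (4 ℕ.* (m ℕ.* ∑-quotients m))) (trans (cong (ι 2 *_) (trans (ι-* 4 (m ℕ.* ∑-quotients m)) (cong (ι 4 *_) (ι-* m (∑-quotients m))))) (ring₁ (ι m) (ι (∑-quotients m))))) ⟩
  ι 8 * ι m * ι (∑-quotients m) * s                 ≤⟨ *-monoʳ-≤-nonNeg s (*-monoˡ-≤-nonNeg (ι 8 * ι m) (≤-trans (∑-quotients-≤ m) (*-monoˡ-≤-nonNeg (ι m) h²≤))) ⟩
  -- The constant 32: a factor 2 from the block excess, 2 from the signs, 2 from the weight 2 d, and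
  -- 2² from H ≤ 2 log.
  ι 8 * ι m * (ι m * (ι 2 * l * (ι 2 * l))) * s     ≡⟨ ring₂ (ι m) l s ⟩
  ι 32 * (ι m * ι m * s) * (l * l)                  ≡⟨ cong (λ k → ι 32 * k * (l * l)) (trans (/≡ι*⅟ (m ^ 2) (φ m)) (cong (_* s) (trans (cong (λ k → ι (m ℕ.* k)) (ℕ.*-identityʳ m)) (ι-* m m)))) ⟨
  ι 32 * (+ (m ^ 2) / φ m) * (l * l)                ∎
  where
  open ≤-Reasoning
  instance
    φ≢0 = φ-nonZero m
    s≥0 = /-nonNeg 1 (φ m)
    m≥0 = /-nonNeg m 1
    8m≥0 = nonNeg*nonNeg⇒nonNeg (ι 8) (ι m)
  E = off-diagonal-cost m V
  s = ⅟ (φ m)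
  l = log-seq m n
  -- A prime v in V has v ≥ 2, hence m ≥ v² ≥ 4.
  4≤m : 4 ℕ.≤ m
  4≤m = ℕ.≤-trans (ℕ.*-mono-≤ {2} {v} {2} 2≤v (ℕ.*-mono-≤ {2} {v} {1} 2≤v ℕ.≤-refl)) v²≤m
    where
    2≤v : 2 ℕ.≤ v
    2≤v = ℕ.nonTrivial⇒n>1 v {{prime⇒nonTrivial v-prime}}
  h²≤ : harmonic m * harmonic m ≤ ι 2 * l * (ι 2 * l)
  h²≤ = square-mono (nonNegative⁻¹ _ {{harmonic-nonNeg m}}) (harmonic-≤-2log-seq n 4≤m)
  ring₁ : ∀ m q → ι 2 * (ι 4 * (m * q)) ≡ ι 8 * m * q
  ring₁ = solve 2 (λ m q → con (ι 2) :* (con (ι 4) :* (m :* q)) := con (ι 8) :* m :* q) refl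
    where open +-*-Solver
  ring₂ : ∀ m l s → ι 8 * m * (m * (ι 2 * l * (ι 2 * l))) * s ≡ ι 32 * (m * m * s) * (l * l)
  ring₂ = solve 3 (λ m l s → con (ι 8) :* m :* (m :* (con (ι 2) :* l :* (con (ι 2) :* l))) :* s := con (ι 32) :* (m :* m :* s) :* (l :* l)) refl
    where open +-*-Solver

theorem1 : ∃ λ (C : ℚ) →
    ∀ (m : ℕ) .{{_ : NonZero m}} (V : List ℕ) (S : ℤ) (L : ℕ) →
    Unique V →
    All (λ v → Prime v × Coprime v m × v ^ 2 ℕ.≤ m) V →
    0 ℕ.< L → L ℕ.≤ m →
    let #V = length V
        main = (+ (#V ^ 2 ℕ.* L ^ 2) / m + + (#V ℕ.* L) / 1) - + (#V ℕ.* L ^ 2) / m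
    in fromℚ ∣ + J m V S L / 1 - main ∣
         ≤ᴿ fromℚ (C * (+ (m ^ 2) / φ m) {{φ-nonZero m}}) *ᴿ (log m *ᴿ log m)
-- The bound holds with every single term of `log-seq`, so it passes to the limit with threshold 0
-- and ε as mere slack.
theorem1 = ι 32 , λ m V S L V-unique V-admissible _ L≤m ε 0<ε → 0 , λ n _ →
  ≤-trans (J-error-≤ {S = S} V-unique V-admissible L≤m) (≤-trans (cost-≤-log V-unique V-admissible n) (≤-+ʳ (<⇒≤ 0<ε)))
  where
  ≤-+ʳ : ∀ {p q} → 0ℚ ≤ q → p ≤ p + q
  ≤-+ʳ {p} 0≤q = subst (_≤ p + _) (+-identityʳ p) (+-monoʳ-≤ p 0≤q)
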